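{- Let $n$ and $a_{\ell+1}$ be positive integers and let $a_0,a_j,b_j\in\mathbb{N}_0$, $c_j\in\mathbb{N}$ with $c_j\ge3$ for $1\le j\le\ell$. Then $H_n^\star[\mathbf{s}]=-\sum_{(\mathbf{p};\tilde{\mathbf{p}};\tilde{\tilde{\mathbf{p}}})\in\Pi(\mathbf{s})}\mathcal{H}_n[\mathbf{p};\tilde{\mathbf{p}};\tilde{\tilde{\mathbf{p}}}]$ in each of the following two cases. (A) $\ell\in\mathbb{N}$, $\mathbf{s}=(\{2\}^{b_1},c_1,\{2\}^{a_1},1,\dots,\{2\}^{b_\ell},c_\ell,\{2\}^{a_\ell},1,\{2\}^{a_{\ell+1}})$, and $\Pi(\mathbf{s})=\{\overline{2b_1+2}\circ1^{\circ(c_1-3)}\circ\overline{2a_1+2}\circ\cdots\circ\overline{2b_\ell+2}\circ1^{\circ(c_\ell-3)}\circ\overline{2a_\ell+2}\circ\overline{2a_{\ell+1}};\ (b_1+1)\circ0^{\circ(c_1-3)}\circ(a_1+1)\circ\cdots\circ(b_\ell+1)\circ0^{\circ(c_\ell-3)}\circ(a_\ell+1)\circ a_{\ell+1};\ 1\circ\theta^{\circ(c_1-3)}\circ1\circ\big((-1)\circ\theta^{\circ(c_2-3)}\circ1\big)\circ\cdots\circ\big((-1)\circ\theta^{\circ(c_\ell-3)}\circ1\big)\circ(-1)\}$, i.e. the third string is $1,\theta^{c_1-3},1$, followed for each $j=2,\dots,\ell$ by the block $-1,\theta^{c_j-3},1$, followed by a final $-1$. (B) $\ell\in\mathbb{N}_0$,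 $\mathbf{s}=(\{2\}^{a_0},1,\{2\}^{b_1},c_1,\{2\}^{a_1},1,\dots,\{2\}^{b_\ell},c_\ell,\{2\}^{a_\ell},1,\{2\}^{a_{\ell+1}})$, and $\Pi(\mathbf{s})=\{(2a_0+1)\circ\overline{2b_1+2}\circ1^{\circ(c_1-3)}\circ\overline{2a_1+2}\circ\cdots\circ\overline{2b_\ell+2}\circ1^{\circ(c_\ell-3)}\circ\overline{2a_\ell+2}\circ\overline{2a_{\ell+1}};\ (a_0+1)\circ(b_1+1)\circ0^{\circ(c_1-3)}\circ(a_1+1)\circ\cdots\circ(b_\ell+1)\circ0^{\circ(c_\ell-3)}\circ(a_\ell+1)\circ a_{\ell+1};\ 2\circ\big((-1)\circ\theta^{\circ(c_1-3)}\circ1\big)\circ\cdots\circ\big((-1)\circ\theta^{\circ(c_\ell-3)}\circ1\big)\circ(-1)\}$, i.e. the third string is $2$, followed for each $j=1,\dots,\ell$ by the block $-1,\theta^{c_j-3},1$, followed by a final $-1$.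
   Context: Fix $0<q<1$. $[k]=(1-q^k)/(1-q)$; $(x;q)_n=\prod_{i=0}^{n-1}(1-xq^i)$; $\binom{n}{k}_q=(q;q)_n/((q;q)_k(q;q)_{n-k})$ for $0\le k\le n$, else $0$. $\{x\}^a$ denotes $a$ copies of $x$. Signed numbers: $\mathbb{D}_0=\mathbb{N}_0\cup\{\bar k:k\in\mathbb{N}_0\}$ ($\bar k$ a formal symbol), $|k|=|\bar k|=k$, $\operatorname{sgn}(k)=1$, $\operatorname{sgn}(\bar k)=-1$; $a\oplus b=\overline{|a|+|b|}$ if exactly one of $a,b$ is unbarred, $a+b$ if both unbarred, $|a|+|b|$ if both barred. For $\mathbf{s}\in\mathbb{D}_0^m$: $H_n^\star[\mathbf{s}]=\sum_{n\ge k_1\ge\cdots\ge k_m\ge1}\prod_{j}\operatorname{sgn}(s_j)^{k_j}q^{k_j}/[k_j]^{|s_j|}$. $\theta$ is a formal symbol; $Q(r,k)=rk(k-1)/2$ if $r\in\mathbb{Z},r>0$; $Q(r,k)=rk(k-1)/2-k$ if $r\in\mathbb{Z},r\le0$; $Q(\theta,k)=0$. On $\mathbb{Z}\cup\{\theta\}$: $\theta\boxplus a=a\boxplus\theta=a$; $a\boxplus b=a+b$ for integers with $(a,b)\neq(1,-1),(-1,1)$; $1\boxplus(-1)=\theta$, $(-1)\boxplus1=0$; iterated $\boxplus$ evaluated left to right. For $\mathbf{s}\in\mathbb{D}_0^m$, $\mathbf{t}\in\mathbb{N}_0^m$, $\mathbf{r}\in(\mathbb{Z}\cup\{\theta\})^m$,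 $m\ge1$: $$\mathcal{H}_n[\mathbf{s};\mathbf{t};\mathbf{r}]=\sum_{n\ge k_1>\cdots>k_m\ge1}\frac{\binom{n}{k_1}_q}{\binom{n+k_1}{k_1}_q}\prod_{j=1}^m\frac{\operatorname{sgn}(s_j)^{k_j}q^{t_jk_j+Q(r_j,k_j)}(1+q^{k_j})}{[k_j]^{|s_j|}}.$$ Merging notation: the set $\{x_1\circ\cdots\circ x_N;y_1\circ\cdots\circ y_N;z_1\circ\cdots\circ z_N\}$ consists of the triples obtained from all $2^{N-1}$ choices, for each of the $N-1$ gaps, of a comma or a merge (same choice in all three strings); each maximal run of merged entries becomes one entry: its $\oplus$-sum in the first string, ordinary sum in the second, $\boxplus$-combination in the third; sums over such a set run over all $2^{N-1}$ choices. $x^{\circ k}$ means $k$ copies of $x$ separated by $\circ$ (empty if $k=0$, with the adjoining $\circ$ dropped).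
   Formalization: The number q is taken to be a rational number with 0<q<1 rather than an arbitrary real one; both sides are rational functions of q, so the real case follows by continuity. -}

module Defs where

open import Data.Nat as ℕ using (ℕ; zero; suc; _∸_; _≤_)
open import Data.Integer as ℤ using (ℤ; +_; +[1+_]; -[1+_])
open import Data.Rational using (ℚ; 0ℚ; 1ℚ; _+_; _*_; _-_; 1/_; ≢-nonZero)
open import Data.Rational.Properties using (_≟_)
open import Data.List using (List; []; _∷_; _++_; [_]; map; replicate; concatMap)
open import Data.Product using (_×_; _,_)
open import Relation.Nullary using (yes; no)

-- total inverse (1/p for p ≠ 0; 0 otherwise).  Only ever applied to
-- nonzero quantities when 0 < q < 1.
inv : ℚ → ℚ
inv p with p ≟ 0ℚ
... | yes _ = 0ℚ
... | no ne = 1/_ p {{≢-nonZero ne}}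

_^_ : ℚ → ℕ → ℚ
p ^ zero = 1ℚ
p ^ suc n = p * (p ^ n)

_^ᶻ_ : ℚ → ℤ → ℚ
p ^ᶻ (+ n) = p ^ n
p ^ᶻ (-[1+ n ]) = inv (p ^ suc n)

sumTo : ℕ → (ℕ → ℚ) → ℚ
sumTo zero f = 0ℚ
sumTo (suc n) f = sumTo n f + f (suc n)

sumL : List ℚ → ℚ
sumL [] = 0ℚ
sumL (x ∷ xs) = x + sumL xs

qint : ℚ → ℕ → ℚ
qint q k = (1ℚ - q ^ k) * inv (1ℚ - q)

qpoch : ℚ → ℕ → ℚ
qpoch q zero = 1ℚ
qpoch q (suc n) = qpoch q n * (1ℚ - q ^ suc n)

qbinom : ℚ → ℕ → ℕ → ℚ
qbinom q n k with k ℕ.≤? n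
... | yes _ = qpoch q n * inv (qpoch q k * qpoch q (n ∸ k))
... | no _ = 0ℚ

data D : Set where
  pos : ℕ → D
  bar : ℕ → D

∣_∣ᴰ : D → ℕ
∣ pos k ∣ᴰ = k
∣ bar k ∣ᴰ = k

sgnPow : D → ℕ → ℚ
sgnPow (pos _) k = 1ℚ
sgnPow (bar _) zero = 1ℚ
sgnPow (bar m) (suc k) = (0ℚ - 1ℚ) * sgnPow (bar m) k

_⊕_ : D → D → D
pos a ⊕ pos b = pos (a ℕ.+ b)
bar a ⊕ bar b = pos (a ℕ.+ b)
pos a ⊕ bar b = bar (a ℕ.+ b)
bar a ⊕ pos b = bar (a ℕ.+ b)

data R : Set where
  int : ℤ → R
  θ   : R

_⊞_ : R → R → R
θ ⊞ a = a
int a ⊞ θ = int a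
int (+ 1) ⊞ int (-[1+ 0 ]) = θ
int a ⊞ int b = int (a ℤ.+ b)

tri : ℕ → ℕ
tri zero = 0
tri (suc k) = tri k ℕ.+ k

Qf : R → ℕ → ℤ
Qf θ k = + 0
Qf (int +[1+ r ]) k = +[1+ r ] ℤ.* (+ tri k)
Qf (int (+ 0)) k = (+ 0) ℤ.* (+ tri k) ℤ.- (+ k)
Qf (int -[1+ r ]) k = -[1+ r ] ℤ.* (+ tri k) ℤ.- (+ k)

Hstar : ℚ → ℕ → List D → ℚ
Hstar q n [] = 1ℚ
Hstar q n (s ∷ ss) =
  sumTo n (λ k → sgnPow s k * (q ^ k) * inv (qint q k ^ ∣ s ∣ᴰ) * Hstar q k ss)

-- 𝓗_n[s;t;r]; entries are triples (s_j, t_j, r_j)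

Triple : Set
Triple = D × ℕ × R

calTerm : ℚ → Triple → ℕ → ℚ
calTerm q (s , t , r) k =
  sgnPow s k * (q ^ᶻ ((+ (t ℕ.* k)) ℤ.+ Qf r k)) * (1ℚ + q ^ k)
    * inv (qint q k ^ ∣ s ∣ᴰ)

strictTail : ℚ → ℕ → List Triple → ℚ
strictTail q k [] = 1ℚ
strictTail q k (x ∷ xs) = sumTo (k ∸ 1) (λ j → calTerm q x j * strictTail q j xs)

ratio : ℚ → ℕ → ℕ → ℚ
ratio q n k = qbinom q n k * inv (qbinom q (n ℕ.+ k) k)

-- 𝓗_n (only used for m ≥ 1; value 0 on the empty list is irrelevant)
calH : ℚ → ℕ → List Triple → ℚ
calH q n [] = 0ℚ
calH q n (x ∷ xs) =
  sumTo n (λ k → ratio q n k * calTerm q x k * strictTail q k xs)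

combine : Triple → Triple → Triple
combine (s , t , r) (s' , t' , r') = (s ⊕ s') , (t ℕ.+ t') , (r ⊞ r')

-- all 2^{N-1} ways of merging adjacent entries (left-to-right combination)
mergesFrom : Triple → List Triple → List (List Triple)
mergesFrom x [] = [ x ∷ [] ]
mergesFrom x (y ∷ rest) =
  map (x ∷_) (mergesFrom y rest) ++ mergesFrom (combine x y) rest

merges : List Triple → List (List Triple)
merges [] = [ [] ]
merges (x ∷ xs) = mergesFrom x xs

sumMerges : ℚ → ℕ → List Triple → ℚ
sumMerges q n xs = sumL (map (calH q n) (merges xs))

record Block : Set where
  constructor blk
  field
    b : ℕ
    c : ℕ
    a : ℕ
open Block public

sBlock : Block → List D
sBlock β = replicate (b β) (pos 2) ++ pos (c β) ∷ replicate (a β) (pos 2) ++ [ pos 1 ]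

sA : List Block → ℕ → List D
sA βs aL = concatMap sBlock βs ++ replicate aL (pos 2)

sB : ℕ → List Block → ℕ → List D
sB a0 βs aL = replicate a0 (pos 2) ++ pos 1 ∷ sA βs aL

piBlock : R → Block → List Triple
piBlock r₀ β =
  (bar (2 ℕ.* b β ℕ.+ 2) , b β ℕ.+ 1 , r₀)
  ∷ replicate (c β ∸ 3) (pos 1 , 0 , θ)
  ++ [ (bar (2 ℕ.* a β ℕ.+ 2) , a β ℕ.+ 1 , int (+ 1)) ]

piFinal : ℕ → List Triple
piFinal aL = [ (bar (2 ℕ.* aL) , aL , int (-[1+ 0 ])) ]

-- Π(s) in case (A), first block given separately (ℓ ≥ 1)
piA : Block → List Block → ℕ → List Triple
piA β₁ βs aL =
  piBlock (int (+ 1)) β₁ ++ concatMap (piBlock (int (-[1+ 0 ]))) βs ++ piFinal aL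

piB : ℕ → List Block → ℕ → List Triple
piB a0 βs aL =
  (pos (2 ℕ.* a0 ℕ.+ 1) , a0 ℕ.+ 1 , int (+ 2))
  ∷ concatMap (piBlock (int (-[1+ 0 ]))) βs ++ piFinal aL

cOK : Block → Set
cOK β = 3 ≤ c β

{-# OPTIONS --safe #-}

-- Write R(n,k) for the ratio of q-binomials, [k] for q-integers, and
-- (T f)(n) = Σ_{k=1}^n R(n,k) (1 + q^k) f(k).  Every H⋆ of the theorem is -T f for a
-- suitable f, and f is followed while the entries of s are prepended from right to left:
--   * -1 = T((-1)^k q^{k(k-1)/2}), which starts the recursion at the empty word;
--   * R(n,k) - R(n-1,k) = q^{n-k} ([k]/[n])² R(n,k), so prepending 2 multiplies f(k) by q^k/[k]²;
--   * if p(k+1) = q^{2k} p(k) + z(k+1) + q^k z(k), then T([k] p)(n) = [n] (T z)(n).  Prepending 1 is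
--     multiplication by [n] followed by prepending 2, and prepending c ≥ 3 is c - 2 divisions by [n]
--     followed by prepending 2.
-- Solving the last recurrence for p or for z gives a partial sum over j ≤ k whose diagonal term has
-- no factor 1 + q^j: strict inequality is a comma, equality is a merge, and this produces Π(s).

module Submission where

open import Defs
open import Data.Nat as ℕ using (ℕ; zero; suc; _∸_; _≤_; s≤s)
import Data.Nat.Properties as ℕₚ
open import Data.Integer as ℤ using (ℤ; +_; +[1+_]; -[1+_]; _⊖_)
import Data.Integer.Properties as ℤₚ
import Data.Integer.Tactic.RingSolver as ℤ-Solver
open import Data.Rational using (ℚ; 0ℚ; 1ℚ; _<_; -_; _+_; _*_; _-_; ≢-nonZero; positive)
open import Data.Rational.Properties
open import Data.List using (List; []; _∷_; _++_; map; replicate; concatMap)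
open import Data.List.Properties using (map-++; map-∘; map-cong; ++-assoc; ++-identityʳ)
open import Data.List.Relation.Unary.All using (All; []; _∷_)
open import Data.Product using (_×_; _,_)
open import Data.Sum using (inj₁; inj₂)
open import Data.Unit using (⊤; tt)
open import Function using (_∘_)
open import Relation.Nullary using (Dec; yes; no; contradiction)
open import Relation.Nullary.Decidable using (dec⇒maybe)
open import Relation.Binary.PropositionalEquality using (_≡_; _≢_; refl; sym; trans; cong; cong₂; subst; subst₂; ≢-sym; module ≡-Reasoning)
open import Tactic.RingSolver using (solve-∀)
open import Tactic.RingSolver.Core.AlmostCommutativeRing using (AlmostCommutativeRing; fromCommutativeRing)

open ≡-Reasoning

-- Arithmetic of the total inverse and of powers.

ℚ-ring : AlmostCommutativeRing _ _
ℚ-ring = fromCommutativeRing +-*-commutativeRing λ x → dec⇒maybe (0ℚ ≟ x)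

inv-inverseʳ : ∀ {p} → p ≢ 0ℚ → p * inv p ≡ 1ℚ
inv-inverseʳ {p} p≢0 with p ≟ 0ℚ
... | yes p≡0 = contradiction p≡0 p≢0
... | no  ne  = *-inverseʳ p {{≢-nonZero ne}}

*-inv-cancelˡ : ∀ {p} → p ≢ 0ℚ → ∀ r → inv p * (p * r) ≡ r
*-inv-cancelˡ {p} p≢0 r = begin
  inv p * (p * r) ≡⟨ swap (inv p) p r ⟩
  p * inv p * r   ≡⟨ cong (_* r) (inv-inverseʳ p≢0) ⟩
  1ℚ * r          ≡⟨ *-identityˡ r ⟩
  r               ∎
  where
  swap : ∀ i p r → i * (p * r) ≡ p * i * r
  swap = solve-∀ ℚ-ring

*-cancelˡ-≢0 : ∀ {p r s} → p ≢ 0ℚ → p * r ≡ p * s → r ≡ s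
*-cancelˡ-≢0 {p} {r} {s} p≢0 eq =
  trans (sym (*-inv-cancelˡ p≢0 r)) (trans (cong (inv p *_) eq) (*-inv-cancelˡ p≢0 s))

*-≢0 : ∀ {p r} → p ≢ 0ℚ → r ≢ 0ℚ → p * r ≢ 0ℚ
*-≢0 {p} p≢0 r≢0 eq = r≢0 (*-cancelˡ-≢0 p≢0 (trans eq (sym (*-zeroʳ p))))

inv-unique : ∀ {p r} → p ≢ 0ℚ → p * r ≡ 1ℚ → inv p ≡ r
inv-unique p≢0 eq = *-cancelˡ-≢0 p≢0 (trans (inv-inverseʳ p≢0) (sym eq))

-- The convention `inv 0ℚ = 0ℚ` settles the zero cases, so inverse powers of `qint q k` may be split
-- and joined even at `k = 0`, where `qint q 0` vanishes.
inv-* : ∀ p r → inv (p * r) ≡ inv p * inv r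
inv-* p r = go (p ≟ 0ℚ) (r ≟ 0ℚ)
  where
  swap : ∀ a b c d → a * b * (c * d) ≡ (a * c) * (b * d)
  swap = solve-∀ ℚ-ring
  go : Dec (p ≡ 0ℚ) → Dec (r ≡ 0ℚ) → inv (p * r) ≡ inv p * inv r
  go (yes refl) _ = trans (cong inv (*-zeroˡ r)) (sym (*-zeroˡ (inv r)))
  go (no _) (yes refl) = trans (cong inv (*-zeroʳ p)) (sym (*-zeroʳ (inv p)))
  go (no p≢0) (no r≢0) = inv-unique (*-≢0 p≢0 r≢0)
    (trans (swap p r (inv p) (inv r)) (cong₂ _*_ (inv-inverseʳ p≢0) (inv-inverseʳ r≢0)))

inv-involutive : ∀ {p} → p ≢ 0ℚ → inv (inv p) ≡ p
inv-involutive {p} p≢0 = inv-unique i≢0 (trans (*-comm (inv p) p) (inv-inverseʳ p≢0))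
  where
  i≢0 : inv p ≢ 0ℚ
  i≢0 eq = contradiction (trans (sym (inv-inverseʳ p≢0)) (trans (cong (p *_) eq) (*-zeroʳ p))) λ ()

^-+ : ∀ p m n → p ^ (m ℕ.+ n) ≡ p ^ m * p ^ n
^-+ p zero    n = sym (*-identityˡ _)
^-+ p (suc m) n = trans (cong (p *_) (^-+ p m n)) (sym (*-assoc p _ _))

^-≢0 : ∀ {p} → p ≢ 0ℚ → ∀ n → p ^ n ≢ 0ℚ
^-≢0 p≢0 zero    = λ ()
^-≢0 p≢0 (suc n) = *-≢0 p≢0 (^-≢0 p≢0 n)

inv-^-+ : ∀ p m n → inv (p ^ (m ℕ.+ n)) ≡ inv (p ^ m) * inv (p ^ n)
inv-^-+ p m n = trans (cong inv (^-+ p m n)) (inv-* (p ^ m) (p ^ n))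

^ᶻ-⊖ : ∀ {p} → p ≢ 0ℚ → ∀ m n → p ^ᶻ (m ⊖ n) ≡ p ^ m * inv (p ^ n)
^ᶻ-⊖ p≢0 m       zero    = sym (*-identityʳ _)
^ᶻ-⊖ p≢0 zero    (suc n) = sym (*-identityˡ _)
^ᶻ-⊖ {p} p≢0 (suc m) (suc n) = begin
  p ^ᶻ (suc m ⊖ suc n)                    ≡⟨ cong (p ^ᶻ_) (ℤₚ.[1+m]⊖[1+n]≡m⊖n m n) ⟩
  p ^ᶻ (m ⊖ n)                            ≡⟨ ^ᶻ-⊖ p≢0 m n ⟩
  p ^ m * inv (p ^ n)                     ≡⟨ sym (*-identityˡ _) ⟩
  1ℚ * (p ^ m * inv (p ^ n))              ≡⟨ cong (_* (p ^ m * inv (p ^ n))) (sym (inv-inverseʳ p≢0)) ⟩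
  p * inv p * (p ^ m * inv (p ^ n))       ≡⟨ swap p _ _ _ ⟩
  p * p ^ m * (inv p * inv (p ^ n))       ≡⟨ cong (p * p ^ m *_) (sym (inv-* p _)) ⟩
  p ^ suc m * inv (p ^ suc n)             ∎
  where
  swap : ∀ a b c d → a * b * (c * d) ≡ a * c * (b * d)
  swap = solve-∀ ℚ-ring

^ᶻ-+ : ∀ {p} → p ≢ 0ℚ → ∀ x y → p ^ᶻ (x ℤ.+ y) ≡ p ^ᶻ x * p ^ᶻ y
^ᶻ-+ {p} p≢0 (+ m)    (+ n)    = ^-+ p m n
^ᶻ-+ p≢0 (+ m)    -[1+ n ] = ^ᶻ-⊖ p≢0 m (suc n)
^ᶻ-+ {p} p≢0 -[1+ m ] (+ n)    = trans (^ᶻ-⊖ p≢0 n (suc m)) (*-comm (p ^ n) (inv (p ^ suc m)))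
^ᶻ-+ {p} p≢0 -[1+ m ] -[1+ n ] =
  trans (cong (λ i → inv (p ^ suc i)) (sym (ℕₚ.+-suc m n))) (inv-^-+ p (suc m) (suc n))

^ᶻ-neg : ∀ p n → p ^ᶻ (ℤ.- (+ n)) ≡ inv (p ^ n)
^ᶻ-neg p zero    = refl
^ᶻ-neg p (suc n) = refl

-- Finite sums, signs and division.

sumTo-cong : ∀ n {f g : ℕ → ℚ} → (∀ k → k ℕ.< n → f (suc k) ≡ g (suc k)) → sumTo n f ≡ sumTo n g
sumTo-cong zero    eq = refl
sumTo-cong (suc n) eq = cong₂ _+_ (sumTo-cong n λ k k<n → eq k (ℕₚ.m<n⇒m<1+n k<n)) (eq n ℕₚ.≤-refl)

sumTo-*ˡ : ∀ n c (f : ℕ → ℚ) → sumTo n (λ k → c * f k) ≡ c * sumTo n f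
sumTo-*ˡ zero    c f = sym (*-zeroʳ c)
sumTo-*ˡ (suc n) c f = trans (cong (_+ c * f (suc n)) (sumTo-*ˡ n c f)) (sym (*-distribˡ-+ c _ _))

sumTo-+ : ∀ n (f g : ℕ → ℚ) → sumTo n (λ k → f k + g k) ≡ sumTo n f + sumTo n g
sumTo-+ zero    f g = refl
sumTo-+ (suc n) f g = trans (cong (_+ (f (suc n) + g (suc n))) (sumTo-+ n f g)) (swap (sumTo n f) (sumTo n g) (f (suc n)) (g (suc n)))
  where
  swap : ∀ a b c d → a + b + (c + d) ≡ a + c + (b + d)
  swap = solve-∀ ℚ-ring

-- `sgnPow (bar m) k` does not depend on `m`, but only propositionally; `bar 0` is the chosen
-- representative.
sgn : ℕ → ℚ
sgn = sgnPow (bar 0)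

sgnPow-bar : ∀ m k → sgnPow (bar m) k ≡ sgn k
sgnPow-bar m zero    = refl
sgnPow-bar m (suc k) = cong ((0ℚ - 1ℚ) *_) (sgnPow-bar m k)

sgn-square : ∀ k → sgn k * sgn k ≡ 1ℚ
sgn-square zero    = refl
sgn-square (suc k) = trans (swap (sgn k)) (sgn-square k)
  where
  swap : ∀ s → (0ℚ - 1ℚ) * s * ((0ℚ - 1ℚ) * s) ≡ s * s
  swap = solve-∀ ℚ-ring

sgnPow-⊕ : ∀ s s' k → sgnPow (s ⊕ s') k ≡ sgnPow s k * sgnPow s' k
sgnPow-⊕ (pos a) (pos b) k = refl
sgnPow-⊕ (pos a) (bar b) k = trans (trans (sgnPow-bar (a ℕ.+ b) k) (sym (sgnPow-bar b k))) (sym (*-identityˡ _))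
sgnPow-⊕ (bar a) (pos b) k = trans (trans (sgnPow-bar (a ℕ.+ b) k) (sym (sgnPow-bar a k))) (sym (*-identityʳ _))
sgnPow-⊕ (bar a) (bar b) k = sym (trans (cong₂ _*_ (sgnPow-bar a k) (sgnPow-bar b k)) (sgn-square k))

∣⊕∣ : ∀ s s' → ∣ s ⊕ s' ∣ᴰ ≡ ∣ s ∣ᴰ ℕ.+ ∣ s' ∣ᴰ
∣⊕∣ (pos a) (pos b) = refl
∣⊕∣ (pos a) (bar b) = refl
∣⊕∣ (bar a) (pos b) = refl
∣⊕∣ (bar a) (bar b) = refl

1-≢0 : ∀ {x} → x < 1ℚ → 1ℚ - x ≢ 0ℚ
1-≢0 {x} x<1 eq = <⇒≢ x<1 (trans (shift x) (cong (λ y → 1ℚ - y) eq))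
  where
  shift : ∀ x → x ≡ 1ℚ - (1ℚ - x)
  shift = solve-∀ ℚ-ring

inv-*-cancelʳ : ∀ p {x} → x ≢ 0ℚ → inv (p * x) * x ≡ inv p
inv-*-cancelʳ p {x} x≢0 = begin
  inv (p * x) * x     ≡⟨ cong (_* x) (inv-* p x) ⟩
  inv p * inv x * x   ≡⟨ swap (inv p) (inv x) x ⟩
  inv p * (x * inv x) ≡⟨ cong (inv p *_) (inv-inverseʳ x≢0) ⟩
  inv p * 1ℚ          ≡⟨ *-identityʳ (inv p) ⟩
  inv p               ∎
  where
  swap : ∀ p i x → p * i * x ≡ p * (x * i)
  swap = solve-∀ ℚ-ring

divide-through : ∀ {X Y Z M N} → M ≢ 0ℚ → N ≢ 0ℚ → X * N ≡ Y * N + Z * M →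
  X * inv M ≡ Y * inv M + Z * inv N
divide-through {X} {Y} {Z} {M} {N} M≢0 N≢0 eq = begin
  X * inv M                           ≡⟨ pad X (inv M) ⟩
  X * inv M * 1ℚ                      ≡⟨ cong (X * inv M *_) (sym (inv-inverseʳ N≢0)) ⟩
  X * inv M * (N * inv N)             ≡⟨ swap X N (inv M) (inv N) ⟩
  X * N * (inv M * inv N)             ≡⟨ cong (_* (inv M * inv N)) eq ⟩
  (Y * N + Z * M) * (inv M * inv N)   ≡⟨ swap′ Y N Z M (inv M) (inv N) ⟩
  Y * inv M * (N * inv N) + Z * inv N * (M * inv M)
    ≡⟨ cong₂ (λ a b → Y * inv M * a + Z * inv N * b) (inv-inverseʳ N≢0) (inv-inverseʳ M≢0) ⟩
  Y * inv M * 1ℚ + Z * inv N * 1ℚ     ≡⟨ cong₂ _+_ (sym (pad Y (inv M))) (sym (pad Z (inv N))) ⟩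
  Y * inv M + Z * inv N               ∎
  where
  pad : ∀ a b → a * b ≡ a * b * 1ℚ
  pad = solve-∀ ℚ-ring
  swap : ∀ X N m n → X * m * (N * n) ≡ X * N * (m * n)
  swap = solve-∀ ℚ-ring
  swap′ : ∀ Y N Z M m n → (Y * N + Z * M) * (m * n) ≡ Y * m * (N * n) + Z * n * (M * m)
  swap′ = solve-∀ ℚ-ring

-- Sums over lists and over merge choices.

sumTo-neg : ∀ n f → sumTo n (λ k → - f k) ≡ - sumTo n f
sumTo-neg zero    f = refl
sumTo-neg (suc n) f = trans (cong (_+ - f (suc n)) (sumTo-neg n f)) (sym (neg-distrib-+ (sumTo n f) (f (suc n))))

sumL-++ : ∀ xs ys → sumL (xs ++ ys) ≡ sumL xs + sumL ys
sumL-++ []       ys = sym (+-identityˡ (sumL ys))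
sumL-++ (x ∷ xs) ys = trans (cong (λ u → x + u) (sumL-++ xs ys)) (sym (+-assoc x (sumL xs) (sumL ys)))

sumL-map-*ˡ : ∀ {A : Set} c (f : A → ℚ) xs → sumL (map (λ x → c * f x) xs) ≡ c * sumL (map f xs)
sumL-map-*ˡ c f []       = sym (*-zeroʳ c)
sumL-map-*ˡ c f (x ∷ xs) = trans (cong (λ u → c * f x + u) (sumL-map-*ˡ c f xs)) (sym (*-distribˡ-+ c (f x) (sumL (map f xs))))

sumTo-zero : ∀ n → sumTo n (λ _ → 0ℚ) ≡ 0ℚ
sumTo-zero zero    = refl
sumTo-zero (suc n) = trans (+-identityʳ _) (sumTo-zero n)

sumL-sumTo : ∀ {A : Set} n (f : ℕ → A → ℚ) xs →
  sumL (map (λ x → sumTo n (λ k → f k x)) xs) ≡ sumTo n (λ k → sumL (map (f k) xs))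
sumL-sumTo n f []       = sym (sumTo-zero n)
sumL-sumTo n f (x ∷ xs) = trans (cong (λ u → sumTo n (λ k → f k x) + u) (sumL-sumTo n f xs))
  (sym (sumTo-+ n (λ k → f k x) (λ k → sumL (map (f k) xs))))

sumL-mergesFrom-cons : ∀ (F : List Triple → ℚ) x y l →
  sumL (map F (mergesFrom x (y ∷ l)))
    ≡ sumL (map (F ∘ (x ∷_)) (mergesFrom y l)) + sumL (map F (mergesFrom (combine x y) l))
sumL-mergesFrom-cons F x y l = begin
  sumL (map F (map (x ∷_) (mergesFrom y l) ++ mergesFrom (combine x y) l))
    ≡⟨ cong sumL (map-++ F (map (x ∷_) (mergesFrom y l)) (mergesFrom (combine x y) l)) ⟩
  sumL (map F (map (x ∷_) (mergesFrom y l)) ++ map F (mergesFrom (combine x y) l))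
    ≡⟨ sumL-++ (map F (map (x ∷_) (mergesFrom y l))) (map F (mergesFrom (combine x y) l)) ⟩
  sumL (map F (map (x ∷_) (mergesFrom y l))) + sumL (map F (mergesFrom (combine x y) l))
    ≡⟨ cong (λ ys → sumL ys + sumL (map F (mergesFrom (combine x y) l))) (sym (map-∘ (mergesFrom y l))) ⟩
  sumL (map (F ∘ (x ∷_)) (mergesFrom y l)) + sumL (map F (mergesFrom (combine x y) l)) ∎

-- Every element of `mergesFrom x l` is nonempty, so agreement on nonempty lists is enough. This
-- matters for `strictTail`, whose value on `[]` is 1 while the corresponding sum of head terms is
-- 0.
sumL-mergesFrom-cong : ∀ (F G : List Triple → ℚ) → (∀ x l → F (x ∷ l) ≡ G (x ∷ l)) →
  ∀ x l → sumL (map F (mergesFrom x l)) ≡ sumL (map G (mergesFrom x l))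
sumL-mergesFrom-cong F G F≗G x []      = cong (_+ 0ℚ) (F≗G x [])
sumL-mergesFrom-cong F G F≗G x (y ∷ l) = begin
  sumL (map F (mergesFrom x (y ∷ l)))
    ≡⟨ sumL-mergesFrom-cons F x y l ⟩
  sumL (map (F ∘ (x ∷_)) (mergesFrom y l)) + sumL (map F (mergesFrom (combine x y) l))
    ≡⟨ cong₂ _+_ (cong sumL (map-cong (F≗G x) (mergesFrom y l))) (sumL-mergesFrom-cong F G F≗G (combine x y) l) ⟩
  sumL (map (G ∘ (x ∷_)) (mergesFrom y l)) + sumL (map G (mergesFrom (combine x y) l))
    ≡⟨ sym (sumL-mergesFrom-cons G x y l) ⟩
  sumL (map G (mergesFrom x (y ∷ l))) ∎

-- Exponents of merged runs.

-- Exponent contributed by an entry merged into its predecessor.  It differs from Qf only for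
-- integers r ≤ 0, where the extra -k of Qf is charged to the first entry of a merged run.
slope : R → ℕ → ℤ
slope θ       k = + 0
slope (int z) k = z ℤ.* (+ tri k)

Additive : R → R → Set
Additive r r′ = ∀ k → Qf (r ⊞ r′) k ≡ Qf r k ℤ.+ slope r′ k

-- Follows every merge choice: after each entry the current run has value `r ⊞ r′` if the entry was
-- merged, and `r′` if a comma started a new run.
Compatible : R → List Triple → Set
Compatible r []                 = ⊤
Compatible r ((_ , _ , r′) ∷ l) = Additive r r′ × Compatible (r ⊞ r′) l × Compatible r′ l

-- A merged run preceding an entry 1 never has value 0 and one preceding an entry -1 never has
-- value θ; these two facts are preserved along Π(s) and are exactly what additivity of Qf needs.
⊞-θ : ∀ r → r ⊞ θ ≡ r
⊞-θ θ       = refl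
⊞-θ (int z) = refl

additive-θ : ∀ r → Additive r θ
additive-θ r k = trans (cong (λ r → Qf r k) (⊞-θ r)) (sym (ℤₚ.+-identityʳ (Qf r k)))

-- The excluded value is where additivity fails: 0 ⊞ 1 = 1 would lose the `-k` present in
-- `Qf (int (+ 0))`. By contrast (-1) ⊞ 1 = 0 keeps it, as it should.
additive-1 : ∀ r → r ≢ int (+ 0) → Additive r (int (+ 1))
additive-1 θ                   _  k = sym (ℤₚ.+-identityˡ _)
additive-1 (int (+ 0))         r≢0 k = contradiction refl r≢0
additive-1 (int (+ 1))         _  k = lem (+ tri k)
  where
  lem : ∀ t → + 2 ℤ.* t ≡ ℤ.1ℤ ℤ.* t ℤ.+ ℤ.1ℤ ℤ.* t
  lem = ℤ-Solver.solve-∀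
additive-1 (int (+ suc (suc n))) _  k =
  trans (cong (λ i → +[1+ suc i ] ℤ.* (+ tri k)) (ℕₚ.+-comm n 1)) (lem (+[1+ suc n ]) (+ tri k))
  where
  lem : ∀ z t → (ℤ.1ℤ ℤ.+ z) ℤ.* t ≡ z ℤ.* t ℤ.+ ℤ.1ℤ ℤ.* t
  lem = ℤ-Solver.solve-∀
additive-1 (int -[1+ 0 ])      _  k = lem (+ tri k) (+ k)
  where
  lem : ∀ t k → ℤ.0ℤ ℤ.* t ℤ.- k ≡ (ℤ.-1ℤ ℤ.* t ℤ.- k) ℤ.+ ℤ.1ℤ ℤ.* t
  lem = ℤ-Solver.solve-∀
additive-1 (int -[1+ suc n ])  _  k = lem (-[1+ suc n ]) (+ tri k) (+ k)
  where
  lem : ∀ z t k → (z ℤ.+ ℤ.1ℤ) ℤ.* t ℤ.- k ≡ (z ℤ.* t ℤ.- k) ℤ.+ ℤ.1ℤ ℤ.* t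
  lem = ℤ-Solver.solve-∀

-- Here 1 ⊞ (-1) = `θ` is essential: an integer 0 would bring in a `-k` that the leading 1 does not
-- have. For the same reason `θ` is excluded on the left, since `θ` ⊞ (-1) = -1 would create one.
additive-₋1 : ∀ r → r ≢ θ → Additive r (int -[1+ 0 ])
additive-₋1 θ                       r≢θ k = contradiction refl r≢θ
additive-₋1 (int (+ 0))             _   k = lem (+ tri k) (+ k)
  where
  lem : ∀ t k → ℤ.-1ℤ ℤ.* t ℤ.- k ≡ (ℤ.0ℤ ℤ.* t ℤ.- k) ℤ.+ ℤ.-1ℤ ℤ.* t
  lem = ℤ-Solver.solve-∀
additive-₋1 (int (+ 1))             _   k = lem (+ tri k)
  where
  lem : ∀ t → ℤ.0ℤ ≡ ℤ.1ℤ ℤ.* t ℤ.+ ℤ.-1ℤ ℤ.* t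
  lem = ℤ-Solver.solve-∀
additive-₋1 (int (+ suc (suc n)))   _   k = lem (+[1+ suc n ]) (+ tri k)
  where
  lem : ∀ z t → (z ℤ.+ ℤ.-1ℤ) ℤ.* t ≡ z ℤ.* t ℤ.+ ℤ.-1ℤ ℤ.* t
  lem = ℤ-Solver.solve-∀
additive-₋1 (int -[1+ n ])          _   k = lem (-[1+ n ]) (+ tri k) (+ k)
  where
  lem : ∀ z t k → (z ℤ.+ ℤ.-1ℤ) ℤ.* t ℤ.- k ≡ (z ℤ.* t ℤ.- k) ℤ.+ ℤ.-1ℤ ℤ.* t
  lem = ℤ-Solver.solve-∀

⊞1≢θ : ∀ r → r ⊞ int (+ 1) ≢ θ
⊞1≢θ θ                  ()
⊞1≢θ (int (+ 0))        ()
⊞1≢θ (int (+ 1))        ()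
⊞1≢θ (int (+ suc (suc n))) ()
⊞1≢θ (int -[1+ n ])     ()

⊞₋1≢0 : ∀ r → r ⊞ int -[1+ 0 ] ≢ int (+ 0)
⊞₋1≢0 θ                  ()
⊞₋1≢0 (int (+ 0))        ()
⊞₋1≢0 (int (+ 1))        ()
⊞₋1≢0 (int (+ suc (suc n))) ()
⊞₋1≢0 (int -[1+ n ])     ()

-- Block structure of the words and of their merge strings.

tailEntries : List Block → ℕ → List Triple
tailEntries βs aL = concatMap (piBlock (int -[1+ 0 ])) βs ++ piFinal aL

edge : R → ℕ → Triple
edge r b = bar (2 ℕ.* b ℕ.+ 2) , b ℕ.+ 1 , r

innerEntries : Block → List Triple → List Triple
innerEntries β l = replicate (c β ∸ 3) (pos 1 , 0 , θ) ++ edge (int (+ 1)) (a β) ∷ l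

piBlock-++ : ∀ r β l → piBlock r β ++ l ≡ edge r (b β) ∷ innerEntries β l
piBlock-++ r β l = cong (edge r (b β) ∷_) (++-assoc (replicate (c β ∸ 3) (pos 1 , 0 , θ)) _ l)

tailEntries-∷ : ∀ β βs aL →
  tailEntries (β ∷ βs) aL ≡ edge (int -[1+ 0 ]) (b β) ∷ innerEntries β (tailEntries βs aL)
tailEntries-∷ β βs aL = trans
  (++-assoc (piBlock (int -[1+ 0 ]) β) (concatMap (piBlock (int -[1+ 0 ])) βs) (piFinal aL))
  (piBlock-++ (int -[1+ 0 ]) β (tailEntries βs aL))

sA-∷ : ∀ β βs aL →
  sA (β ∷ βs) aL ≡ replicate (b β) (pos 2) ++ pos (c β) ∷ replicate (a β) (pos 2) ++ pos 1 ∷ sA βs aL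
sA-∷ β βs aL = trans
  (++-assoc (sBlock β) (concatMap sBlock βs) (replicate aL (pos 2)))
  (trans (++-assoc (replicate (b β) (pos 2)) (pos (c β) ∷ replicate (a β) (pos 2) ++ (pos 1 ∷ [])) (sA βs aL))
         (cong (λ ss → replicate (b β) (pos 2) ++ pos (c β) ∷ ss)
           (++-assoc (replicate (a β) (pos 2)) (pos 1 ∷ []) (sA βs aL))))

-- `θ` is neutral, so a run that reaches the closing entry 1 of the block from the left still has
-- value `r` or `θ`, both different from 0; after that entry no run has value `θ`.
compatible-inner : ∀ r β l → r ≢ int (+ 0) → (∀ r′ → r′ ≢ θ → Compatible r′ l) → Compatible r (innerEntries β l)
compatible-inner r β l r≢0 compat = go (c β ∸ 3) r r≢0
  where
  go : ∀ m r → r ≢ int (+ 0) →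
    Compatible r (replicate m (pos 1 , 0 , θ) ++ edge (int (+ 1)) (a β) ∷ l)
  go zero    r r≢0 = additive-1 r r≢0 , compat (r ⊞ int (+ 1)) (⊞1≢θ r) , compat (int (+ 1)) λ ()
  go (suc m) r r≢0 = additive-θ r , go m (r ⊞ θ) (λ eq → r≢0 (trans (sym (⊞-θ r)) eq)) , go m θ λ ()

compatible-tail : ∀ βs aL r → r ≢ θ → Compatible r (tailEntries βs aL)
compatible-tail []       aL r r≢θ = additive-₋1 r r≢θ , tt , tt
compatible-tail (β ∷ βs) aL r r≢θ = subst (Compatible r) (sym (tailEntries-∷ β βs aL))
  ( additive-₋1 r r≢θ
  , compatible-inner (r ⊞ int -[1+ 0 ]) β (tailEntries βs aL) (⊞₋1≢0 r) (compatible-tail βs aL)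
  , compatible-inner (int -[1+ 0 ]) β (tailEntries βs aL) (λ ()) (compatible-tail βs aL))

module Expansion (q : ℚ) (0<q : 0ℚ < q) (q<1 : q < 1ℚ) where

  -- Nonvanishing of powers, Pochhammer symbols and q-integers.

  q≢0 : q ≢ 0ℚ
  q≢0 = ≢-sym (<⇒≢ 0<q)

  q^≢0 : ∀ k → q ^ k ≢ 0ℚ
  q^≢0 = ^-≢0 q≢0

  q^suc<1 : ∀ k → q ^ suc k < 1ℚ
  q^suc<1 zero    = subst (_< 1ℚ) (sym (*-identityʳ q)) q<1
  q^suc<1 (suc k) = <-trans (subst (q ^ suc (suc k) <_) (*-identityʳ q) (*-monoʳ-<-pos q {{positive 0<q}} (q^suc<1 k))) q<1

  1-q^≢0 : ∀ k → 1ℚ - q ^ suc k ≢ 0ℚ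
  1-q^≢0 k = 1-≢0 (q^suc<1 k)

  qpoch≢0 : ∀ n → qpoch q n ≢ 0ℚ
  qpoch≢0 zero    = λ ()
  qpoch≢0 (suc n) = *-≢0 (qpoch≢0 n) (1-q^≢0 n)

  inv[1-q]≢0 : inv (1ℚ - q) ≢ 0ℚ
  inv[1-q]≢0 eq = contradiction
    (trans (sym (inv-inverseʳ (1-≢0 q<1))) (trans (cong ((1ℚ - q) *_) eq) (*-zeroʳ (1ℚ - q)))) λ ()

  qint≢0 : ∀ k → qint q (suc k) ≢ 0ℚ
  qint≢0 k = *-≢0 (1-q^≢0 k) inv[1-q]≢0

  qint-zero : qint q 0 ≡ 0ℚ
  qint-zero = *-zeroˡ (inv (1ℚ - q))

  -- The ratio of q-binomials.

  qbinom-≤ : ∀ {n k} → k ≤ n → qbinom q n k ≡ qpoch q n * inv (qpoch q k * qpoch q (n ∸ k))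
  qbinom-≤ {n} {k} k≤n with k ℕ.≤? n
  ... | yes _  = refl
  ... | no k≰n = contradiction k≤n k≰n

  qbinom-> : ∀ {n k} → n ℕ.< k → qbinom q n k ≡ 0ℚ
  qbinom-> {n} {k} n<k with k ℕ.≤? n
  ... | yes k≤n = contradiction k≤n (ℕₚ.<⇒≱ n<k)
  ... | no _    = refl

  -- The factors `qpoch q k` of the two binomials cancel. The difference of `n` and `k` is carried
  -- as `d` with an equation, which keeps truncated subtraction out of the identities below.
  ratio-closed : ∀ n k d → n ≡ d ℕ.+ k →
    ratio q n k ≡ qpoch q n * qpoch q n * (inv (qpoch q d) * inv (qpoch q (n ℕ.+ k)))
  ratio-closed n k d refl = begin
    qbinom q n k * inv (qbinom q (n ℕ.+ k) k)
      ≡⟨ cong₂ (λ x y → x * inv y) (qbinom-≤ (ℕₚ.m≤n+m k d)) (qbinom-≤ (ℕₚ.m≤n+m k n)) ⟩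
    P n * inv (P k * P (n ∸ k)) * inv (P (n ℕ.+ k) * inv (P k * P (n ℕ.+ k ∸ k)))
      ≡⟨ cong₂ (λ i j → P n * inv (P k * P i) * inv (P (n ℕ.+ k) * inv (P k * P j)))
           (ℕₚ.m+n∸n≡m d k) (ℕₚ.m+n∸n≡m n k) ⟩
    P n * inv (P k * P d) * inv (P (n ℕ.+ k) * inv (P k * P n))
      ≡⟨ cong₂ (λ x y → P n * x * y) (inv-* (P k) (P d)) (inv-* (P (n ℕ.+ k)) (inv (P k * P n))) ⟩
    P n * (inv (P k) * inv (P d)) * (inv (P (n ℕ.+ k)) * inv (inv (P k * P n)))
      ≡⟨ cong (λ y → P n * (inv (P k) * inv (P d)) * (inv (P (n ℕ.+ k)) * y))
           (inv-involutive (*-≢0 (qpoch≢0 k) (qpoch≢0 n))) ⟩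
    P n * (inv (P k) * inv (P d)) * (inv (P (n ℕ.+ k)) * (P k * P n))
      ≡⟨ swap (P n) (inv (P k)) (inv (P d)) (inv (P (n ℕ.+ k))) (P k) ⟩
    P k * inv (P k) * (P n * P n * (inv (P d) * inv (P (n ℕ.+ k))))
      ≡⟨ trans (cong (_* (P n * P n * (inv (P d) * inv (P (n ℕ.+ k))))) (inv-inverseʳ (qpoch≢0 k))) (*-identityˡ _) ⟩
    P n * P n * (inv (P d) * inv (P (n ℕ.+ k))) ∎
    where
    P = qpoch q
    swap : ∀ N K δ M k → N * (K * δ) * (M * (k * N)) ≡ k * K * (N * N * (δ * M))
    swap = solve-∀ ℚ-ring

  ratio-zero : ∀ n → ratio q n 0 ≡ 1ℚ
  ratio-zero n = begin
    ratio q n 0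
      ≡⟨ ratio-closed n 0 n (sym (ℕₚ.+-identityʳ n)) ⟩
    P n * P n * (inv (P n) * inv (P (n ℕ.+ 0)))
      ≡⟨ cong (λ i → P n * P n * (inv (P n) * inv (P i))) (ℕₚ.+-identityʳ n) ⟩
    P n * P n * (inv (P n) * inv (P n))
      ≡⟨ swap (P n) (inv (P n)) ⟩
    P n * inv (P n) * (P n * inv (P n))
      ≡⟨ cong₂ _*_ (inv-inverseʳ (qpoch≢0 n)) (inv-inverseʳ (qpoch≢0 n)) ⟩
    1ℚ ∎
    where
    P = qpoch q
    swap : ∀ N i → N * N * (i * i) ≡ N * i * (N * i)
    swap = solve-∀ ℚ-ring

  ratio-> : ∀ n → ratio q n (suc n) ≡ 0ℚ
  ratio-> n = trans (cong (_* inv (qbinom q (n ℕ.+ suc n) (suc n))) (qbinom-> (ℕₚ.n<1+n n)))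
    (*-zeroˡ (inv (qbinom q (n ℕ.+ suc n) (suc n))))

  ratio-sucʳ : ∀ n k d → n ≡ d ℕ.+ suc k →
    ratio q n (suc k) * (1ℚ - q ^ (n ℕ.+ suc k)) ≡ ratio q n k * (1ℚ - q ^ suc d)
  ratio-sucʳ n k d eq = begin
    ratio q n (suc k) * (1ℚ - q ^ (n ℕ.+ suc k))
      ≡⟨ cong (_* (1ℚ - q ^ (n ℕ.+ suc k))) (ratio-closed n (suc k) d eq) ⟩
    P n * P n * (inv (P d) * inv (P (n ℕ.+ suc k))) * (1ℚ - q ^ (n ℕ.+ suc k))
      ≡⟨ cong (λ i → P n * P n * (inv (P d) * inv (P i)) * (1ℚ - q ^ i)) (ℕₚ.+-suc n k) ⟩
    P n * P n * (inv (P d) * inv (P (suc (n ℕ.+ k)))) * (1ℚ - q ^ suc (n ℕ.+ k))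
      ≡⟨ swap (P n * P n) (inv (P d)) (inv (P (suc (n ℕ.+ k)))) (1ℚ - q ^ suc (n ℕ.+ k)) ⟩
    P n * P n * (inv (P d) * (inv (P (suc (n ℕ.+ k))) * (1ℚ - q ^ suc (n ℕ.+ k))))
      ≡⟨ cong₂ (λ x y → P n * P n * (x * y)) (sym (inv-*-cancelʳ (P d) (1-q^≢0 d)))
           (inv-*-cancelʳ (P (n ℕ.+ k)) (1-q^≢0 (n ℕ.+ k))) ⟩
    P n * P n * (inv (P (suc d)) * (1ℚ - q ^ suc d) * inv (P (n ℕ.+ k)))
      ≡⟨ swap′ (P n * P n) (inv (P (suc d))) (1ℚ - q ^ suc d) (inv (P (n ℕ.+ k))) ⟩
    P n * P n * (inv (P (suc d)) * inv (P (n ℕ.+ k))) * (1ℚ - q ^ suc d)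
      ≡⟨ cong (_* (1ℚ - q ^ suc d)) (sym (ratio-closed n k (suc d) (trans eq (ℕₚ.+-suc d k)))) ⟩
    ratio q n k * (1ℚ - q ^ suc d) ∎
    where
    P = qpoch q
    swap : ∀ a b c d → a * (b * c) * d ≡ a * (b * (c * d))
    swap = solve-∀ ℚ-ring
    swap′ : ∀ a b c d → a * (b * c * d) ≡ a * (b * d) * c
    swap′ = solve-∀ ℚ-ring

  ratio-sucˡ : ∀ n k d → n ≡ d ℕ.+ k →
    ratio q (suc n) k * ((1ℚ - q ^ suc d) * (1ℚ - q ^ suc (n ℕ.+ k)))
      ≡ ratio q n k * ((1ℚ - q ^ suc n) * (1ℚ - q ^ suc n))
  ratio-sucˡ n k d eq = begin
    ratio q (suc n) k * (x * y)
      ≡⟨ cong (_* (x * y)) (ratio-closed (suc n) k (suc d) (cong suc eq)) ⟩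
    P n * z * (P n * z) * (inv (P d * x) * inv (P (n ℕ.+ k) * y)) * (x * y)
      ≡⟨ swap (P n) z (inv (P d * x)) (inv (P (n ℕ.+ k) * y)) x y ⟩
    P n * P n * (inv (P d * x) * x * (inv (P (n ℕ.+ k) * y) * y)) * (z * z)
      ≡⟨ cong₂ (λ u v → P n * P n * (u * v) * (z * z)) (inv-*-cancelʳ (P d) (1-q^≢0 d))
           (inv-*-cancelʳ (P (n ℕ.+ k)) (1-q^≢0 (n ℕ.+ k))) ⟩
    P n * P n * (inv (P d) * inv (P (n ℕ.+ k))) * (z * z)
      ≡⟨ cong (_* (z * z)) (sym (ratio-closed n k d eq)) ⟩
    ratio q n k * (z * z) ∎
    where
    P = qpoch q
    x = 1ℚ - q ^ suc d
    y = 1ℚ - q ^ suc (n ℕ.+ k)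
    z = 1ℚ - q ^ suc n
    swap : ∀ P z i j x y → P * z * (P * z) * (i * j) * (x * y) ≡ P * P * (i * x * (j * y)) * (z * z)
    swap = solve-∀ ℚ-ring

  -- The transform and its three identities.

  T : (ℕ → ℚ) → ℕ → ℚ
  T f n = sumTo n (λ k → ratio q n k * ((1ℚ + q ^ k) * f k))

  T-cong : ∀ {f g} → (∀ k → f (suc k) ≡ g (suc k)) → ∀ n → T f n ≡ T g n
  T-cong eq n = sumTo-cong n λ k _ → cong (λ y → ratio q n (suc k) * ((1ℚ + q ^ suc k) * y)) (eq k)

  -- Turns every power of `q` in the telescoping steps into a monomial in `q`, `q ^ d` and `q ^ k`,
  -- so that what remains is a polynomial identity.
  q^-split : ∀ n k d → n ≡ d ℕ.+ suc k → q ^ n ≡ q ^ d * (q * q ^ k)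
  q^-split n k d refl = ^-+ q d (suc k)

  -- The difference of the two summands has the antidifference R(n,m) ([m] - [n]) (q^m p(m) + z(m)):
  -- `init` makes it vanish at m = 0, and `rec` together with `ratio-sucʳ` makes its increments the
  -- summands.
  T-qint : ∀ (p z : ℕ → ℚ) → q ^ 0 * p 0 + z 0 ≡ 0ℚ →
    (∀ k → p (suc k) ≡ q ^ k * q ^ k * p k + z (suc k) + q ^ k * z k) →
    ∀ n → T (λ k → qint q k * p k) n ≡ qint q n * T z n
  T-qint p z init rec n = begin
    T (λ k → qint q k * p k) n
      ≡⟨ sumTo-cong n (λ k _ → split (ratio q n (suc k)) (1ℚ + q ^ suc k) (qint q (suc k) * p (suc k)) (qint q n) (z (suc k))) ⟩
    sumTo n (λ k → s k + qint q n * t k)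
      ≡⟨ sumTo-+ n s (λ k → qint q n * t k) ⟩
    sumTo n s + sumTo n (λ k → qint q n * t k)
      ≡⟨ cong₂ _+_ (partial n 0 refl) (sumTo-*ˡ n (qint q n) t) ⟩
    ratio q n n * ((qint q n - qint q n) * (q ^ n * p n + z n)) + qint q n * T z n
      ≡⟨ vanish (ratio q n n) (qint q n) (q ^ n * p n + z n) (qint q n * T z n) ⟩
    qint q n * T z n ∎
    where
    t s : ℕ → ℚ
    t k = ratio q n k * ((1ℚ + q ^ k) * z k)
    s k = ratio q n k * ((1ℚ + q ^ k) * (qint q k * p k - qint q n * z k))

    split : ∀ ρ a f N z → ρ * (a * f) ≡ ρ * (a * (f - N * z)) + N * (ρ * (a * z))
    split = solve-∀ ℚ-ring

    vanish : ∀ ρ N y w → ρ * ((N - N) * y) + w ≡ w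
    vanish = solve-∀ ℚ-ring

    collect : ∀ ρ q x δ i p z →
      ρ * (((1ℚ - x) * i - (1ℚ - δ * (q * x)) * i) * (x * p + z)) ≡ ρ * (1ℚ - q * δ) * (- (x * i) * (x * p + z))
    collect = solve-∀ ℚ-ring

    step : ∀ ρ q x δ i p z z′ →
      ρ * (1ℚ - δ * (q * x) * (q * x)) * (- (x * i) * (x * p + z))
        + ρ * ((1ℚ + q * x) * ((1ℚ - q * x) * i * (x * x * p + z′ + x * z) - (1ℚ - δ * (q * x)) * i * z′))
      ≡ ρ * (((1ℚ - q * x) * i - (1ℚ - δ * (q * x)) * i) * (q * x * (x * x * p + z′ + x * z) + z′))
    step = solve-∀ ℚ-ring

    -- The summands telescope: the factor [m] - [n] kills the sum at m = n.
    partial : ∀ m d → n ≡ d ℕ.+ m →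
      sumTo m s ≡ ratio q n m * ((qint q m - qint q n) * (q ^ m * p m + z m))
    partial zero d eq = sym (trans
      (cong (λ y → ratio q n 0 * ((qint q 0 - qint q n) * y)) init)
      (trans (cong (ratio q n 0 *_) (*-zeroʳ (qint q 0 - qint q n))) (*-zeroʳ (ratio q n 0))))
    partial (suc m) d eq = begin
      sumTo m s + s (suc m)
        ≡⟨ cong (_+ s (suc m)) (partial m (suc d) (trans eq (ℕₚ.+-suc d m))) ⟩
      ratio q n m * ((qint q m - qint q n) * (x * p m + z m)) + s (suc m)
        ≡⟨ cong (λ y → ratio q n m * ((qint q m - (1ℚ - y) * i) * (x * p m + z m)) + s (suc m)) q^n ⟩
      ratio q n m * ((qint q m - (1ℚ - δ * (q * x)) * i) * (x * p m + z m)) + s (suc m)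
        ≡⟨ cong (_+ s (suc m)) (collect (ratio q n m) q x δ i (p m) (z m)) ⟩
      ratio q n m * (1ℚ - q * δ) * (- (x * i) * (x * p m + z m)) + s (suc m)
        ≡⟨ cong (λ y → y * (- (x * i) * (x * p m + z m)) + s (suc m)) (sym (ratio-sucʳ n m d eq)) ⟩
      ρ * (1ℚ - q ^ (n ℕ.+ suc m)) * (- (x * i) * (x * p m + z m)) + s (suc m)
        ≡⟨ cong (λ y → ρ * (1ℚ - y) * (- (x * i) * (x * p m + z m)) + s (suc m))
             (trans (^-+ q n (suc m)) (cong (_* (q * x)) q^n)) ⟩
      ρ * (1ℚ - δ * (q * x) * (q * x)) * (- (x * i) * (x * p m + z m)) + s (suc m)
        ≡⟨ cong₂ (λ y w → ρ * (1ℚ - δ * (q * x) * (q * x)) * (- (x * i) * (x * p m + z m))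
               + ρ * ((1ℚ + q * x) * (qint q (suc m) * w - (1ℚ - y) * i * z (suc m)))) q^n (rec m) ⟩
      ρ * (1ℚ - δ * (q * x) * (q * x)) * (- (x * i) * (x * p m + z m))
        + ρ * ((1ℚ + q * x) * ((1ℚ - q * x) * i * p′ - (1ℚ - δ * (q * x)) * i * z (suc m)))
        ≡⟨ step ρ q x δ i (p m) (z m) (z (suc m)) ⟩
      ρ * (((1ℚ - q * x) * i - (1ℚ - δ * (q * x)) * i) * (q * x * p′ + z (suc m)))
        ≡⟨ cong₂ (λ y w → ρ * ((qint q (suc m) - (1ℚ - y) * i) * (q * x * w + z (suc m)))) (sym q^n) (sym (rec m)) ⟩
      ρ * ((qint q (suc m) - qint q n) * (q ^ suc m * p (suc m) + z (suc m))) ∎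
      where
      x = q ^ m
      δ = q ^ d
      i = inv (1ℚ - q)
      ρ = ratio q n (suc m)
      p′ = x * x * p m + z (suc m) + x * z m
      q^n = q^-split n m d eq

  -- After multiplication by 1 - q^n the sum up to m is (-1)^m q^(m(m+1)/2) R(n,m) (1 - q^(n-m)) -
  -- (1 - q^n), and at m = n only the last term survives. Dividing back requires a positive
  -- argument, hence `suc n`.
  T-one : ∀ n → T (λ k → sgn k * q ^ tri k) (suc n) ≡ - 1ℚ
  T-one n′ = *-cancelˡ-≢0 (1-q^≢0 n′) (begin
    (1ℚ - q ^ n) * T (λ k → sgn k * q ^ tri k) n
      ≡⟨ partial n 0 refl ⟩
    sgn n * (q ^ tri n * q ^ n) * (ratio q n n * (1ℚ - q ^ 0)) - (1ℚ - q ^ n)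
      ≡⟨ end (sgn n * (q ^ tri n * q ^ n)) (ratio q n n) (1ℚ - q ^ n) ⟩
    (1ℚ - q ^ n) * (- 1ℚ) ∎)
    where
    n = suc n′
    t : ℕ → ℚ
    t k = ratio q n k * ((1ℚ + q ^ k) * (sgn k * q ^ tri k))

    end : ∀ a b c → a * (b * (1ℚ - 1ℚ)) - c ≡ c * (- 1ℚ)
    end = solve-∀ ℚ-ring

    start : ∀ y → y * 0ℚ ≡ 1ℚ * (1ℚ * 1ℚ) * (1ℚ * y) - y
    start = solve-∀ ℚ-ring

    step : ∀ ρ s u q x δ →
      s * (u * x) * (ρ * (1ℚ - δ * (q * x) * (q * x))) - (1ℚ - δ * (q * x))
        + (1ℚ - δ * (q * x)) * (ρ * ((1ℚ + q * x) * ((0ℚ - 1ℚ) * s * (u * x))))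
      ≡ (0ℚ - 1ℚ) * s * (u * x * (q * x)) * (ρ * (1ℚ - δ)) - (1ℚ - δ * (q * x))
    step = solve-∀ ℚ-ring

    partial : ∀ m d → n ≡ d ℕ.+ m →
      (1ℚ - q ^ n) * sumTo m t ≡ sgn m * (q ^ tri m * q ^ m) * (ratio q n m * (1ℚ - q ^ d)) - (1ℚ - q ^ n)
    partial zero d eq = trans (start (1ℚ - q ^ n))
      (cong₂ (λ ρ y → 1ℚ * (1ℚ * 1ℚ) * (ρ * (1ℚ - q ^ y)) - (1ℚ - q ^ n))
        (sym (ratio-zero n)) (trans eq (ℕₚ.+-identityʳ d)))
    partial (suc m) d eq = begin
      (1ℚ - q ^ n) * (sumTo m t + t (suc m))
        ≡⟨ *-distribˡ-+ (1ℚ - q ^ n) (sumTo m t) (t (suc m)) ⟩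
      (1ℚ - q ^ n) * sumTo m t + (1ℚ - q ^ n) * t (suc m)
        ≡⟨ cong (_+ (1ℚ - q ^ n) * t (suc m)) (partial m (suc d) (trans eq (ℕₚ.+-suc d m))) ⟩
      sgn m * (u * x) * (ratio q n m * (1ℚ - q ^ suc d)) - (1ℚ - q ^ n) + (1ℚ - q ^ n) * t (suc m)
        ≡⟨ cong (λ y → sgn m * (u * x) * y - (1ℚ - q ^ n) + (1ℚ - q ^ n) * t (suc m)) (sym (ratio-sucʳ n m d eq)) ⟩
      sgn m * (u * x) * (ρ * (1ℚ - q ^ (n ℕ.+ suc m))) - (1ℚ - q ^ n) + (1ℚ - q ^ n) * t (suc m)
        ≡⟨ cong (λ y → sgn m * (u * x) * (ρ * (1ℚ - y)) - (1ℚ - q ^ n) + (1ℚ - q ^ n) * t (suc m)) (^-+ q n (suc m)) ⟩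
      sgn m * (u * x) * (ρ * (1ℚ - q ^ n * (q * x))) - (1ℚ - q ^ n) + (1ℚ - q ^ n) * t (suc m)
        ≡⟨ cong₂ (λ y w → sgn m * (u * x) * (ρ * (1ℚ - y * (q * x))) - (1ℚ - y)
               + (1ℚ - y) * (ρ * ((1ℚ + q * x) * ((0ℚ - 1ℚ) * sgn m * w)))) q^n (^-+ q (tri m) m) ⟩
      sgn m * (u * x) * (ρ * (1ℚ - δ * (q * x) * (q * x))) - (1ℚ - δ * (q * x))
        + (1ℚ - δ * (q * x)) * (ρ * ((1ℚ + q * x) * ((0ℚ - 1ℚ) * sgn m * (u * x))))
        ≡⟨ step ρ (sgn m) u q x δ ⟩
      sgn (suc m) * (u * x * (q * x)) * (ρ * (1ℚ - δ)) - (1ℚ - δ * (q * x))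
        ≡⟨ cong₂ (λ y w → sgn (suc m) * (w * (q * x)) * (ρ * (1ℚ - δ)) - (1ℚ - y)) (sym q^n) (sym (^-+ q (tri m) m)) ⟩
      sgn (suc m) * (q ^ tri (suc m) * q ^ suc m) * (ρ * (1ℚ - δ)) - (1ℚ - q ^ n) ∎
      where
      x = q ^ m
      u = q ^ tri m
      δ = q ^ d
      ρ = ratio q n (suc m)
      q^n = q^-split n m d eq

  -- With N = n + 1 and K = k + 1 this is (1 - q^N)² - (1 - q^(N-K)) (1 - q^(N+K)) = q^(N-K) (1 -
  -- q^K)², combined with `ratio-sucˡ` and multiplied by q^K to keep exponents nonnegative.
  ratio-diff : ∀ n k → k ℕ.< suc n →
    ratio q (suc n) (suc k) * q ^ suc k * qint q (suc n) ^ 2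
      ≡ ratio q n (suc k) * q ^ suc k * qint q (suc n) ^ 2
        + ratio q (suc n) (suc k) * q ^ suc n * qint q (suc k) ^ 2
  ratio-diff n k (s≤s k≤n) with ℕₚ.m≤n⇒m<n∨m≡n k≤n
  ... | inj₂ refl = begin
    ρ′ * x * N
      ≡⟨ pad (ρ′ * x * N) (x * N) ⟩
    0ℚ * (x * N) + ρ′ * x * N
      ≡⟨ cong (λ y → y * (x * N) + ρ′ * x * N) (sym (ratio-> n)) ⟩
    ratio q n (suc n) * (x * N) + ρ′ * x * N
      ≡⟨ cong (_+ ρ′ * x * N) (sym (*-assoc (ratio q n (suc n)) x N)) ⟩
    ratio q n (suc n) * x * N + ρ′ * x * N ∎
    where
    ρ′ = ratio q (suc n) (suc n)
    x = q ^ suc n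
    N = qint q (suc n) ^ 2
    pad : ∀ a b → a ≡ 0ℚ * b + a
    pad = solve-∀ ℚ-ring
  ... | inj₁ k<n = begin
    ρ′ * x * N q^n
      ≡⟨ cong (λ y → ρ′ * x * N y) eq ⟩
    ρ′ * x * N (δ * x)
      ≡⟨ expand ρ′ q x δ i ⟩
    ρ′ * ((1ℚ - q * δ) * (1ℚ - q * (δ * x * x))) * (x * (i * i)) + ρ′ * (q * (δ * x)) * qint q (suc k) ^ 2
      ≡⟨ cong (λ y → ρ′ * ((1ℚ - q * δ) * (1ℚ - q * y)) * (x * (i * i)) + ρ′ * (q * (δ * x)) * qint q (suc k) ^ 2)
           (sym (trans (^-+ q n (suc k)) (cong (_* x) eq))) ⟩
    ρ′ * ((1ℚ - q * δ) * (1ℚ - q * q ^ (n ℕ.+ suc k))) * (x * (i * i)) + ρ′ * (q * (δ * x)) * qint q (suc k) ^ 2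
      ≡⟨ cong₂ (λ y w → y * (x * (i * i)) + ρ′ * (q * w) * qint q (suc k) ^ 2) (ratio-sucˡ n (suc k) d n≡d+k) (sym eq) ⟩
    ρ * ((1ℚ - q * q^n) * (1ℚ - q * q^n)) * (x * (i * i)) + ρ′ * (q * q^n) * qint q (suc k) ^ 2
      ≡⟨ cong (_+ ρ′ * (q * q^n) * qint q (suc k) ^ 2) (collect ρ (1ℚ - q * q^n) x i) ⟩
    ρ * x * N q^n + ρ′ * (q * q^n) * qint q (suc k) ^ 2 ∎
    where
    d = n ∸ suc k
    n≡d+k : n ≡ d ℕ.+ suc k
    n≡d+k = sym (ℕₚ.m∸n+n≡m k<n)
    q^n = q ^ n
    x = q ^ suc k
    δ = q ^ d
    i = inv (1ℚ - q)
    ρ = ratio q n (suc k)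
    ρ′ = ratio q (suc n) (suc k)
    N : ℚ → ℚ
    N y = ((1ℚ - q * y) * i) ^ 2
    eq : q^n ≡ δ * x
    eq = trans (cong (q ^_) n≡d+k) (^-+ q d (suc k))
    expand : ∀ r q x D i → r * x * ((1ℚ - q * (D * x)) * i * ((1ℚ - q * (D * x)) * i * 1ℚ))
      ≡ r * ((1ℚ - q * D) * (1ℚ - q * (D * x * x))) * (x * (i * i))
        + r * (q * (D * x)) * ((1ℚ - x) * i * ((1ℚ - x) * i * 1ℚ))
    expand = solve-∀ ℚ-ring
    collect : ∀ r z x i → r * (z * z) * (x * (i * i)) ≡ r * x * (z * i * (z * i * 1ℚ))
    collect = solve-∀ ℚ-ring

  weight₂ : ℕ → ℚ
  weight₂ k = q ^ k * inv (qint q k ^ 2)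

  -- Induction on `n`. Divided by both squares, `ratio-diff` splits each summand at n + 1 into the
  -- summand at n plus `weight₂ (suc n)` times a summand of `T f (suc n)`; the surplus term k = n +
  -- 1 of the old sum is zero by `ratio->`.
  T-weight₂ : ∀ f n → T (λ k → weight₂ k * f k) n ≡ sumTo n (λ m → weight₂ m * T f m)
  T-weight₂ f zero    = refl
  T-weight₂ f (suc n) = begin
    sumTo (suc n) (λ k → ratio q (suc n) k * ((1ℚ + q ^ k) * (weight₂ k * f k)))
      ≡⟨ sumTo-cong (suc n) termwise ⟩
    sumTo (suc n) (λ k → old k + weight₂ (suc n) * new k)
      ≡⟨ sumTo-+ (suc n) old (λ k → weight₂ (suc n) * new k) ⟩
    sumTo n old + old (suc n) + sumTo (suc n) (λ k → weight₂ (suc n) * new k)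
      ≡⟨ cong₂ (λ y w → sumTo n old + y * ((1ℚ + q ^ suc n) * (weight₂ (suc n) * f (suc n))) + w)
           (ratio-> n) (sumTo-*ˡ (suc n) (weight₂ (suc n)) new) ⟩
    sumTo n old + 0ℚ * ((1ℚ + q ^ suc n) * (weight₂ (suc n) * f (suc n))) + weight₂ (suc n) * T f (suc n)
      ≡⟨ cong (_+ weight₂ (suc n) * T f (suc n)) (drop (sumTo n old) ((1ℚ + q ^ suc n) * (weight₂ (suc n) * f (suc n)))) ⟩
    T (λ k → weight₂ k * f k) n + weight₂ (suc n) * T f (suc n)
      ≡⟨ cong (_+ weight₂ (suc n) * T f (suc n)) (T-weight₂ f n) ⟩
    sumTo (suc n) (λ m → weight₂ m * T f m) ∎
    where
    old new : ℕ → ℚ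
    old k = ratio q n k * ((1ℚ + q ^ k) * (weight₂ k * f k))
    new k = ratio q (suc n) k * ((1ℚ + q ^ k) * f k)

    drop : ∀ a b → a + 0ℚ * b ≡ a
    drop = solve-∀ ℚ-ring

    pull : ∀ r u x i f → r * (u * (x * i * f)) ≡ r * x * i * (u * f)
    pull = solve-∀ ℚ-ring

    push : ∀ r u x i f r′ y j →
      (r * x * i + r′ * y * j) * (u * f) ≡ r * (u * (x * i * f)) + y * j * (r′ * (u * f))
    push = solve-∀ ℚ-ring

    termwise : ∀ k → k ℕ.< suc n →
      ratio q (suc n) (suc k) * ((1ℚ + q ^ suc k) * (weight₂ (suc k) * f (suc k)))
        ≡ old (suc k) + weight₂ (suc n) * new (suc k)
    termwise k k<1+n = begin
      ρ′ * (u * (x * i * f (suc k)))            ≡⟨ pull ρ′ u x i (f (suc k)) ⟩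
      ρ′ * x * i * (u * f (suc k))
        ≡⟨ cong (_* (u * f (suc k))) (divide-through {ρ′ * x} {ρ * x} {ρ′ * y} (^-≢0 (qint≢0 k) 2) (^-≢0 (qint≢0 n) 2) (ratio-diff n k k<1+n)) ⟩
      (ρ * x * i + ρ′ * y * j) * (u * f (suc k)) ≡⟨ push ρ u x i (f (suc k)) ρ′ y j ⟩
      old (suc k) + weight₂ (suc n) * new (suc k) ∎
      where
      ρ = ratio q n (suc k)
      ρ′ = ratio q (suc n) (suc k)
      u = 1ℚ + q ^ suc k
      x = q ^ suc k
      y = q ^ suc n
      i = inv (qint q (suc k) ^ 2)
      j = inv (qint q (suc n) ^ 2)

  -- Star sums as transforms.

  record Represents (f g : ℕ → ℚ) : Set where
    constructor represents
    field
      expansion : ∀ n → g (suc n) ≡ - T f (suc n)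
  open Represents public

  represents-congˡ : ∀ {f f′ g} → (∀ k → f (suc k) ≡ f′ (suc k)) → Represents f g → Represents f′ g
  represents-congˡ f≗f′ rep = represents λ n → trans (expansion rep n) (cong -_ (T-cong f≗f′ (suc n)))

  represents-congʳ : ∀ {f g g′} → (∀ n → g (suc n) ≡ g′ (suc n)) → Represents f g → Represents f g′
  represents-congʳ g≗g′ rep = represents λ n → trans (sym (g≗g′ n)) (expansion rep n)

  -- The transform is 0 at n = 0 while the empty word has value 1; this is why `Represents` speaks
  -- of positive arguments only.
  represents-one : Represents (λ k → sgn k * q ^ tri k) (λ _ → 1ℚ)
  represents-one = represents λ n → sym (cong -_ (T-one n))

  represents-weight₂ : ∀ {f g} → Represents f g →
    Represents (λ k → weight₂ k * f k) (λ n → sumTo n (λ m → weight₂ m * g m))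
  represents-weight₂ {f} {g} rep = represents λ n → begin
    sumTo (suc n) (λ m → weight₂ m * g m)
      ≡⟨ sumTo-cong (suc n) (λ m _ → trans (cong (weight₂ (suc m) *_) (expansion rep m)) (sym (neg-distribʳ-* (weight₂ (suc m)) (T f (suc m))))) ⟩
    sumTo (suc n) (λ m → - (weight₂ m * T f m))
      ≡⟨ sumTo-neg (suc n) (λ m → weight₂ m * T f m) ⟩
    - sumTo (suc n) (λ m → weight₂ m * T f m)
      ≡⟨ cong -_ (sym (T-weight₂ f (suc n))) ⟩
    - T (λ k → weight₂ k * f k) (suc n) ∎

  -- Read as a recurrence for `p`, its homogeneous solution is q^(k(k-1)); read as a recurrence for
  -- `z`, it is (-1)^k q^(k(k-1)/2). These are the prefactors `qtri k * qtri k` at block boundaries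
  -- and `sgn k * qtri k` inside blocks.
  Linked : (p z : ℕ → ℚ) → Set
  Linked p z = q ^ 0 * p 0 + z 0 ≡ 0ℚ
             × (∀ k → p (suc k) ≡ q ^ k * q ^ k * p k + z (suc k) + q ^ k * z k)

  represents-qint : ∀ {p z g} → Linked p z → Represents z g →
    Represents (λ k → qint q k * p k) (λ n → qint q n * g n)
  represents-qint {p} {z} {g} (init , rec) rep = represents λ n → begin
    qint q (suc n) * g (suc n)             ≡⟨ cong (qint q (suc n) *_) (expansion rep n) ⟩
    qint q (suc n) * (- T z (suc n))       ≡⟨ sym (neg-distribʳ-* (qint q (suc n)) (T z (suc n))) ⟩
    - (qint q (suc n) * T z (suc n))       ≡⟨ cong -_ (sym (T-qint p z init rec (suc n))) ⟩
    - T (λ k → qint q k * p k) (suc n)     ∎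

  represents-inv-qint : ∀ {p z g} → Linked p z → Represents (λ k → qint q k * p k) g →
    Represents z (λ n → inv (qint q n) * g n)
  represents-inv-qint {p} {z} {g} (init , rec) rep = represents λ n → begin
    inv (qint q (suc n)) * g (suc n)
      ≡⟨ cong (inv (qint q (suc n)) *_) (expansion rep n) ⟩
    inv (qint q (suc n)) * (- T (λ k → qint q k * p k) (suc n))
      ≡⟨ cong (λ y → inv (qint q (suc n)) * (- y)) (T-qint p z init rec (suc n)) ⟩
    inv (qint q (suc n)) * (- (qint q (suc n) * T z (suc n)))
      ≡⟨ cong (inv (qint q (suc n)) *_) (neg-distribʳ-* (qint q (suc n)) (T z (suc n))) ⟩
    inv (qint q (suc n)) * (qint q (suc n) * (- T z (suc n)))
      ≡⟨ *-inv-cancelˡ (qint≢0 n) (- T z (suc n)) ⟩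
    - T z (suc n)                              ∎

  -- Factoring the sum over merges.

  headTerm : ℕ → List Triple → ℚ
  headTerm k []      = 0ℚ
  headTerm k (x ∷ l) = calTerm q x k * strictTail q k l

  mergedTerm : Triple → List Triple → ℕ → ℚ
  mergedTerm x l k = sumL (map (headTerm k) (mergesFrom x l))

  sumMerges-∷ : ∀ n x l → sumMerges q n (x ∷ l) ≡ sumTo n (λ k → ratio q n k * mergedTerm x l k)
  sumMerges-∷ n x l = begin
    sumL (map (calH q n) (mergesFrom x l))
      ≡⟨ sumL-mergesFrom-cong (calH q n) (λ m → sumTo n (λ k → ratio q n k * headTerm k m))
           (λ y m → sumTo-cong n (λ k _ → *-assoc (ratio q n (suc k)) (calTerm q y (suc k)) (strictTail q (suc k) m))) x l ⟩
    sumL (map (λ m → sumTo n (λ k → ratio q n k * headTerm k m)) (mergesFrom x l))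
      ≡⟨ sumL-sumTo n (λ k m → ratio q n k * headTerm k m) (mergesFrom x l) ⟩
    sumTo n (λ k → sumL (map (λ m → ratio q n k * headTerm k m) (mergesFrom x l)))
      ≡⟨ sumTo-cong n (λ k _ → sumL-map-*ˡ (ratio q n (suc k)) (headTerm (suc k)) (mergesFrom x l)) ⟩
    sumTo n (λ k → ratio q n k * mergedTerm x l k) ∎

  mergedTerm-∷ : ∀ x y l k →
    mergedTerm x (y ∷ l) k ≡ calTerm q x k * sumTo (k ∸ 1) (mergedTerm y l) + mergedTerm (combine x y) l k
  mergedTerm-∷ x y l k = begin
    mergedTerm x (y ∷ l) k
      ≡⟨ sumL-mergesFrom-cons (headTerm k) x y l ⟩
    sumL (map (λ m → calTerm q x k * strictTail q k m) (mergesFrom y l)) + mergedTerm (combine x y) l k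
      ≡⟨ cong (_+ mergedTerm (combine x y) l k) (begin
           sumL (map (λ m → calTerm q x k * strictTail q k m) (mergesFrom y l))
             ≡⟨ sumL-map-*ˡ (calTerm q x k) (strictTail q k) (mergesFrom y l) ⟩
           calTerm q x k * sumL (map (strictTail q k) (mergesFrom y l))
             ≡⟨ cong (calTerm q x k *_) (sumL-mergesFrom-cong (strictTail q k)
                  (λ m → sumTo (k ∸ 1) (λ j → headTerm j m)) (λ _ _ → refl) y l) ⟩
           calTerm q x k * sumL (map (λ m → sumTo (k ∸ 1) (λ j → headTerm j m)) (mergesFrom y l))
             ≡⟨ cong (calTerm q x k *_) (sumL-sumTo (k ∸ 1) headTerm (mergesFrom y l)) ⟩
           calTerm q x k * sumTo (k ∸ 1) (mergedTerm y l) ∎) ⟩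
    calTerm q x k * sumTo (k ∸ 1) (mergedTerm y l) + mergedTerm (combine x y) l k ∎

  -- The factor by which merging an entry into its predecessor multiplies the predecessor's
  -- `calTerm`: the run already carries its `1 + q^k`, and the exponent is `slope` instead of `Qf`.
  weight : Triple → ℕ → ℚ
  weight (s , t , r) k = sgnPow s k * (q ^ (t ℕ.* k) * q ^ᶻ slope r k) * inv (qint q k ^ ∣ s ∣ᴰ)

  -- Total contribution of all merge choices for the entries following one with index k. The first
  -- summand is a merge, which keeps the index; the second is a comma, which lowers it.
  tailSum : List Triple → ℕ → ℚ
  tailSum []      k = 1ℚ
  tailSum (y ∷ l) k = weight y k * tailSum l k + sumTo (k ∸ 1) (λ j → calTerm q y j * tailSum l j)

  calTerm-combine : ∀ s t r s′ t′ r′ → Additive r r′ → ∀ k →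
    calTerm q (combine (s , t , r) (s′ , t′ , r′)) k ≡ calTerm q (s , t , r) k * weight (s′ , t′ , r′) k
  calTerm-combine s t r s′ t′ r′ add k = begin
    sgnPow (s ⊕ s′) k * q ^ᶻ (+ ((t ℕ.+ t′) ℕ.* k) ℤ.+ Qf (r ⊞ r′) k) * (1ℚ + q ^ k) * inv (qint q k ^ ∣ s ⊕ s′ ∣ᴰ)
      ≡⟨ cong₂ (λ a b → a * b * (1ℚ + q ^ k) * inv (qint q k ^ ∣ s ⊕ s′ ∣ᴰ)) (sgnPow-⊕ s s′ k) exponent ⟩
    sgnPow s k * sgnPow s′ k * (e * e′) * (1ℚ + q ^ k) * inv (qint q k ^ ∣ s ⊕ s′ ∣ᴰ)
      ≡⟨ cong (sgnPow s k * sgnPow s′ k * (e * e′) * (1ℚ + q ^ k) *_)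
           (trans (cong (λ i → inv (qint q k ^ i)) (∣⊕∣ s s′)) (inv-^-+ (qint q k) ∣ s ∣ᴰ ∣ s′ ∣ᴰ)) ⟩
    sgnPow s k * sgnPow s′ k * (e * e′) * (1ℚ + q ^ k) * (inv (qint q k ^ ∣ s ∣ᴰ) * inv (qint q k ^ ∣ s′ ∣ᴰ))
      ≡⟨ swap (sgnPow s k) (sgnPow s′ k) e e′ (1ℚ + q ^ k) (inv (qint q k ^ ∣ s ∣ᴰ)) (inv (qint q k ^ ∣ s′ ∣ᴰ)) ⟩
    calTerm q (s , t , r) k * weight (s′ , t′ , r′) k ∎
    where
    e = q ^ᶻ (+ (t ℕ.* k) ℤ.+ Qf r k)
    e′ = q ^ (t′ ℕ.* k) * q ^ᶻ slope r′ k
    swap : ∀ s s′ e e′ u i i′ → s * s′ * (e * e′) * u * (i * i′) ≡ s * e * u * i * (s′ * e′ * i′)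
    swap = solve-∀ ℚ-ring
    shuffle : ∀ a b c d → (a ℤ.+ b) ℤ.+ (c ℤ.+ d) ≡ (a ℤ.+ c) ℤ.+ (b ℤ.+ d)
    shuffle = ℤ-Solver.solve-∀
    exponent : q ^ᶻ (+ ((t ℕ.+ t′) ℕ.* k) ℤ.+ Qf (r ⊞ r′) k) ≡ e * e′
    exponent = begin
      q ^ᶻ (+ ((t ℕ.+ t′) ℕ.* k) ℤ.+ Qf (r ⊞ r′) k)
        ≡⟨ cong₂ (λ m z → q ^ᶻ (+ m ℤ.+ z)) (ℕₚ.*-distribʳ-+ k t t′) (add k) ⟩
      q ^ᶻ ((+ (t ℕ.* k) ℤ.+ + (t′ ℕ.* k)) ℤ.+ (Qf r k ℤ.+ slope r′ k))
        ≡⟨ cong (q ^ᶻ_) (shuffle (+ (t ℕ.* k)) (+ (t′ ℕ.* k)) (Qf r k) (slope r′ k)) ⟩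
      q ^ᶻ ((+ (t ℕ.* k) ℤ.+ Qf r k) ℤ.+ (+ (t′ ℕ.* k) ℤ.+ slope r′ k))
        ≡⟨ ^ᶻ-+ q≢0 (+ (t ℕ.* k) ℤ.+ Qf r k) (+ (t′ ℕ.* k) ℤ.+ slope r′ k) ⟩
      e * q ^ᶻ (+ (t′ ℕ.* k) ℤ.+ slope r′ k)
        ≡⟨ cong (e *_) (^ᶻ-+ q≢0 (+ (t′ ℕ.* k)) (slope r′ k)) ⟩
      e * e′ ∎

  -- Induction on `l` for all heads at once, since a merge replaces the head by `combine x y`.
  -- Additivity of `Qf` lets the head split off, and the exponentially many choices collapse into
  -- the linear recursion of `tailSum`.
  mergedTerm-factor : ∀ s t r l → Compatible r l → ∀ k →
    mergedTerm (s , t , r) l k ≡ calTerm q (s , t , r) k * tailSum l k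
  mergedTerm-factor s t r [] _ k = +-identityʳ _
  mergedTerm-factor s t r ((s′ , t′ , r′) ∷ l) (add , compat , compat′) k = begin
    mergedTerm x (y ∷ l) k
      ≡⟨ mergedTerm-∷ x y l k ⟩
    calTerm q x k * sumTo (k ∸ 1) (mergedTerm y l) + mergedTerm (combine x y) l k
      ≡⟨ cong₂ (λ u v → calTerm q x k * u + v)
           (sumTo-cong (k ∸ 1) (λ j _ → mergedTerm-factor s′ t′ r′ l compat′ (suc j)))
           (mergedTerm-factor (s ⊕ s′) (t ℕ.+ t′) (r ⊞ r′) l compat k) ⟩
    calTerm q x k * rest + calTerm q (combine x y) k * tailSum l k
      ≡⟨ cong (λ u → calTerm q x k * rest + u * tailSum l k) (calTerm-combine s t r s′ t′ r′ add k) ⟩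
    calTerm q x k * rest + calTerm q x k * weight y k * tailSum l k
      ≡⟨ factor (calTerm q x k) rest (weight y k) (tailSum l k) ⟩
    calTerm q x k * tailSum (y ∷ l) k ∎
    where
    x = s , t , r
    y = s′ , t′ , r′
    rest = sumTo (k ∸ 1) (λ j → calTerm q y j * tailSum l j)
    factor : ∀ c r w t → c * r + c * w * t ≡ c * (w * t + r)
    factor = solve-∀ ℚ-ring

  -- Explicit weights for the values 1, 2 and -1.

  qtri : ℕ → ℚ
  qtri k = q ^ tri k

  qtri-suc : ∀ k → qtri (suc k) ≡ qtri k * q ^ k
  qtri-suc k = ^-+ q (tri k) k

  -- Rests on the default value of `inv`: [0] = 0, so a positive power of it has inverse 0. This
  -- supplies the initial condition `x 0 ≡ 0ℚ` when the recurrence is solved.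
  weight-zero : ∀ s t r {m} → ∣ s ∣ᴰ ≡ suc m → weight (s , t , r) 0 ≡ 0ℚ
  weight-zero s t r {m} eq = trans
    (cong (λ i → coeff * inv (qint q 0 ^ i)) eq)
    (trans (cong (λ y → coeff * inv (y * qint q 0 ^ m)) qint-zero)
    (trans (cong (λ y → coeff * inv y) (*-zeroˡ (qint q 0 ^ m))) (*-zeroʳ coeff)))
    where
    coeff = sgnPow s 0 * (q ^ (t ℕ.* 0) * q ^ᶻ slope r 0)

  weight-1 : ∀ s t k → weight (s , t , int (+ 1)) k ≡ sgnPow s k * (q ^ (t ℕ.* k) * qtri k) * inv (qint q k ^ ∣ s ∣ᴰ)
  weight-1 s t k = cong (λ z → sgnPow s k * (q ^ (t ℕ.* k) * q ^ᶻ z) * inv (qint q k ^ ∣ s ∣ᴰ)) (ℤₚ.*-identityˡ (+ tri k))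

  weight-2 : ∀ s t k → weight (s , t , int (+ 2)) k ≡ sgnPow s k * (q ^ (t ℕ.* k) * (qtri k * qtri k)) * inv (qint q k ^ ∣ s ∣ᴰ)
  weight-2 s t k = cong (λ y → sgnPow s k * (q ^ (t ℕ.* k) * y) * inv (qint q k ^ ∣ s ∣ᴰ))
    (trans (cong (q ^ᶻ_) (double (+ tri k))) (^-+ q (tri k) (tri k)))
    where
    double : ∀ t → + 2 ℤ.* t ≡ t ℤ.+ t
    double = ℤ-Solver.solve-∀

  weight-₋1 : ∀ s t k → weight (s , t , int -[1+ 0 ]) k ≡ sgnPow s k * (q ^ (t ℕ.* k) * inv (qtri k)) * inv (qint q k ^ ∣ s ∣ᴰ)
  weight-₋1 s t k = cong (λ y → sgnPow s k * (q ^ (t ℕ.* k) * y) * inv (qint q k ^ ∣ s ∣ᴰ))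
    (trans (cong (q ^ᶻ_) (ℤₚ.-1*i≡-i (+ tri k))) (^ᶻ-neg q (tri k)))

  calTerm-weight : ∀ s t r k → Qf r k ≡ slope r k → calTerm q (s , t , r) k ≡ (1ℚ + q ^ k) * weight (s , t , r) k
  calTerm-weight s t r k eq = trans
    (cong (λ y → sgnPow s k * y * (1ℚ + q ^ k) * inv (qint q k ^ ∣ s ∣ᴰ))
      (trans (cong (λ z → q ^ᶻ (+ (t ℕ.* k) ℤ.+ z)) eq) (^ᶻ-+ q≢0 (+ (t ℕ.* k)) (slope r k))))
    (swap (sgnPow s k) (q ^ (t ℕ.* k) * q ^ᶻ slope r k) (1ℚ + q ^ k) (inv (qint q k ^ ∣ s ∣ᴰ)))
    where
    swap : ∀ s e u i → s * e * u * i ≡ u * (s * e * i)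
    swap = solve-∀ ℚ-ring

  calTerm-weight-₋1 : ∀ s t k →
    calTerm q (s , t , int -[1+ 0 ]) k ≡ inv (q ^ k) * (1ℚ + q ^ k) * weight (s , t , int -[1+ 0 ]) k
  calTerm-weight-₋1 s t k = trans
    (cong (λ y → sgnPow s k * y * (1ℚ + q ^ k) * inv (qint q k ^ ∣ s ∣ᴰ)) (begin
      q ^ᶻ (+ (t ℕ.* k) ℤ.+ (σ ℤ.- + k))         ≡⟨ ^ᶻ-+ q≢0 (+ (t ℕ.* k)) (σ ℤ.- + k) ⟩
      q ^ (t ℕ.* k) * q ^ᶻ (σ ℤ.- + k)           ≡⟨ cong (q ^ (t ℕ.* k) *_) (^ᶻ-+ q≢0 σ (ℤ.- + k)) ⟩
      q ^ (t ℕ.* k) * (q ^ᶻ σ * q ^ᶻ (ℤ.- + k))  ≡⟨ cong (λ y → q ^ (t ℕ.* k) * (q ^ᶻ σ * y)) (^ᶻ-neg q k) ⟩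
      q ^ (t ℕ.* k) * (q ^ᶻ σ * inv (q ^ k))     ∎))
    (swap (sgnPow s k) (q ^ (t ℕ.* k)) (q ^ᶻ σ) (inv (q ^ k)) (1ℚ + q ^ k) (inv (qint q k ^ ∣ s ∣ᴰ)))
    where
    σ = slope (int -[1+ 0 ]) k
    swap : ∀ s e f x u i → s * (e * (f * x)) * u * i ≡ x * u * (s * (e * f) * i)
    swap = solve-∀ ℚ-ring

  -- Solutions of the recurrence as partial sums.

  leading : List Triple → ℕ → ℚ
  leading []      k = 0ℚ
  leading (y ∷ l) k = weight y k * tailSum l k

  -- Common shape of `tailSum` and of the solutions of `Linked`: the diagonal term (merge) stands
  -- without the factor `e`, the terms below it (comma) carry it.
  cum : (ℕ → ℚ) → (ℕ → ℚ) → ℕ → ℚ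
  cum e x k = x k + sumTo (k ∸ 1) (λ j → e j * x j)

  tailSum-cum : ∀ e y l → (∀ k → calTerm q y k ≡ e k * weight y k) → ∀ k → tailSum (y ∷ l) k ≡ cum e (leading (y ∷ l)) k
  tailSum-cum e y l eq k = cong (λ u → weight y k * tailSum l k + u) (sumTo-cong (k ∸ 1) λ j _ →
    trans (cong (_* tailSum l (suc j)) (eq (suc j))) (*-assoc (e (suc j)) (weight y (suc j)) (tailSum l (suc j))))

  e₊ e₋ : ℕ → ℚ
  e₊ k = 1ℚ + q ^ k
  e₋ k = inv (q ^ k) * (1ℚ + q ^ k)

  -- Dividing by [n] inserts an entry of Π(s) that is not preceded by a block boundary.
  linked-cum₊ : ∀ {x} → x 0 ≡ 0ℚ → Linked (λ k → sgn k * qtri k * x k) (λ k → sgn k * qtri k * cum e₊ x k)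
  linked-cum₊ {x} x0 = cong (λ y → 1ℚ * (1ℚ * 1ℚ * y) + 1ℚ * 1ℚ * (y + 0ℚ)) x0 , rec
    where
    zeroth : ∀ u y → u * y ≡ 1ℚ * 1ℚ * (1ℚ * 1ℚ * 0ℚ) + u * (y + 0ℚ) + 1ℚ * (1ℚ * 1ℚ * (0ℚ + 0ℚ))
    zeroth = solve-∀ ℚ-ring
    step : ∀ s t z y w Σ → (0ℚ - 1ℚ) * s * (t * z) * w
      ≡ z * z * (s * t * y) + (0ℚ - 1ℚ) * s * (t * z) * (w + (Σ + (1ℚ + z) * y)) + z * (s * t * (y + Σ))
    step = solve-∀ ℚ-ring
    rec : ∀ k → sgn (suc k) * qtri (suc k) * x (suc k)
      ≡ q ^ k * q ^ k * (sgn k * qtri k * x k) + sgn (suc k) * qtri (suc k) * cum e₊ x (suc k) + q ^ k * (sgn k * qtri k * cum e₊ x k)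
    -- Truncated subtraction leaves the sum in `cum` empty at both k = 0 and k = 1, so the missing
    -- term j = 0 has to vanish by itself, which `x0` provides.
    rec zero = trans (zeroth (sgn 1 * qtri 1) (x 1))
      (cong (λ y → 1ℚ * 1ℚ * (1ℚ * 1ℚ * y) + sgn 1 * qtri 1 * (x 1 + 0ℚ) + 1ℚ * (1ℚ * 1ℚ * (y + 0ℚ))) (sym x0))
    rec (suc j) = subst (λ T′ → sgn (suc k) * T′ * x (suc k)
        ≡ q ^ k * q ^ k * (sgn k * qtri k * x k) + sgn (suc k) * T′ * cum e₊ x (suc k) + q ^ k * (sgn k * qtri k * cum e₊ x k))
      (sym (qtri-suc k))
      (step (sgn k) (qtri k) (q ^ k) (x k) (x (suc k)) (sumTo j (λ i → e₊ i * x i)))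
      where k = suc j

  -- Multiplying by [n] crosses a block boundary; the q^{-k} in e₋ is the -k of Qf (int -1).
  linked-cum₋ : ∀ {x} → x 0 ≡ 0ℚ → Linked (λ k → qtri k * qtri k * cum e₋ x k) (λ k → qtri k * qtri k * x k)
  linked-cum₋ {x} x0 = cong (λ y → 1ℚ * (1ℚ * 1ℚ * (y + 0ℚ)) + 1ℚ * 1ℚ * y) x0 , rec
    where
    zeroth : ∀ u y → u * (y + 0ℚ) ≡ 1ℚ * 1ℚ * (1ℚ * 1ℚ * (0ℚ + 0ℚ)) + u * y + 1ℚ * (1ℚ * 1ℚ * 0ℚ)
    zeroth = solve-∀ ℚ-ring
    expand : ∀ t z i y w Σ → (t * z) * (t * z) * (w + (Σ + i * (1ℚ + z) * y))
      ≡ (t * z) * (t * z) * (w + Σ) + (z * i) * (t * t * z * ((1ℚ + z) * y))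
    expand = solve-∀ ℚ-ring
    step : ∀ t z y w Σ → (t * z) * (t * z) * (w + Σ) + 1ℚ * (t * t * z * ((1ℚ + z) * y))
      ≡ z * z * (t * t * (y + Σ)) + (t * z) * (t * z) * w + z * (t * t * y)
    step = solve-∀ ℚ-ring
    rec : ∀ k → qtri (suc k) * qtri (suc k) * cum e₋ x (suc k)
      ≡ q ^ k * q ^ k * (qtri k * qtri k * cum e₋ x k) + qtri (suc k) * qtri (suc k) * x (suc k) + q ^ k * (qtri k * qtri k * x k)
    rec zero = trans (zeroth (qtri 1 * qtri 1) (x 1))
      (cong (λ y → 1ℚ * 1ℚ * (1ℚ * 1ℚ * (y + 0ℚ)) + qtri 1 * qtri 1 * x 1 + 1ℚ * (1ℚ * 1ℚ * y)) (sym x0))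
    rec (suc j) = subst (λ T′ → T′ * T′ * cum e₋ x (suc k)
        ≡ q ^ k * q ^ k * (qtri k * qtri k * cum e₋ x k) + T′ * T′ * x (suc k) + q ^ k * (qtri k * qtri k * x k))
      (sym (qtri-suc k))
      (trans (expand (qtri k) (q ^ k) (inv (q ^ k)) (x k) (x (suc k)) Σ)
      (trans (cong (λ y → qtri k * q ^ k * (qtri k * q ^ k) * (x (suc k) + Σ) + y * (qtri k * qtri k * q ^ k * ((1ℚ + q ^ k) * x k)))
               (inv-inverseʳ (q^≢0 k)))
             (step (qtri k) (q ^ k) (x k) (x (suc k)) Σ)))
      where
      k = suc j
      Σ = sumTo j (λ i → e₋ i * x i)

  -- Prepending letters to the word.

  star : List D → ℕ → ℚ
  star ss n = Hstar q n ss

  represents-twos : ∀ {f ss} → Represents f (star ss) → ∀ m →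
    Represents (λ k → q ^ (m ℕ.* k) * inv (qint q k ^ (2 ℕ.* m)) * f k) (star (replicate m (pos 2) ++ ss))
  represents-twos {f} {ss} rep zero = represents-congˡ (λ k → sym (*-identityˡ (f (suc k)))) rep
  represents-twos {f} {ss} rep (suc m) = represents-congˡ (λ k → fold (suc k)) (represents-congʳ
    (λ n → sumTo-cong (suc n) λ k _ → cong (_* star (replicate m (pos 2) ++ ss) (suc k))
      (sym (cong (_* inv (qint q (suc k) ^ 2)) (*-identityˡ (q ^ suc k)))))
    (represents-weight₂ (represents-twos {f} {ss} rep m)))
    where
    swap : ∀ x i y j f → x * i * (y * j * f) ≡ x * y * (i * j) * f
    swap = solve-∀ ℚ-ring
    fold : ∀ k → weight₂ k * (q ^ (m ℕ.* k) * inv (qint q k ^ (2 ℕ.* m)) * f k)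
      ≡ q ^ (suc m ℕ.* k) * inv (qint q k ^ (2 ℕ.* suc m)) * f k
    fold k = trans (swap (q ^ k) (inv (qint q k ^ 2)) (q ^ (m ℕ.* k)) (inv (qint q k ^ (2 ℕ.* m))) (f k))
      (cong₂ (λ u v → u * v * f k) (sym (^-+ q k (m ℕ.* k)))
        (trans (sym (inv-^-+ (qint q k) 2 (2 ℕ.* m))) (cong (λ i → inv (qint q k ^ i)) (sym (ℕₚ.*-suc 2 m)))))

  -- `weight₂ k * qint q k` equals q^k/[k], the factor of the letter 1. The multiplication by [n] is
  -- where the recurrence is solved for `p`, turning `x` into `cum e₋ x`.
  represents-1 : ∀ {x ss} → x 0 ≡ 0ℚ → Represents (λ k → qtri k * qtri k * x k) (star ss) →
    Represents (λ k → q ^ k * inv (qint q k ^ 1) * (qtri k * qtri k * cum e₋ x k)) (star (pos 1 ∷ ss))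
  represents-1 {x} {ss} x0 rep = represents-congˡ
    (λ k → cancel k (qtri (suc k) * qtri (suc k) * cum e₋ x (suc k))) (represents-congʳ
    (λ n → sumTo-cong (suc n) λ k _ → trans (cancel k (star ss (suc k)))
      (cong (λ y → y * inv (qint q (suc k) ^ 1) * star ss (suc k)) (sym (*-identityˡ (q ^ suc k)))))
    (represents-weight₂ (represents-qint (linked-cum₋ {x} x0) rep)))
    where
    swap : ∀ x i j n y → x * (i * j) * (n * y) ≡ x * j * (i * (n * y))
    swap = solve-∀ ℚ-ring
    cancel : ∀ k y → weight₂ (suc k) * (qint q (suc k) * y) ≡ q ^ suc k * inv (qint q (suc k) ^ 1) * y
    cancel k y = trans (cong (λ i → q ^ suc k * i * (qint q (suc k) * y)) (inv-* (qint q (suc k)) (qint q (suc k) ^ 1)))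
      (trans (swap (q ^ suc k) (inv (qint q (suc k))) (inv (qint q (suc k) ^ 1)) (qint q (suc k)) y)
             (cong (q ^ suc k * inv (qint q (suc k) ^ 1) *_) (*-inv-cancelˡ (qint≢0 k) y)))

  represents-entry : ∀ s t r l {m} {g} → ∣ s ∣ᴰ ≡ suc m → (∀ k → Qf r k ≡ slope r k) →
    Represents (λ k → qint q k * (sgn k * qtri k * leading ((s , t , r) ∷ l) k)) g →
    Represents (λ k → sgn k * qtri k * tailSum ((s , t , r) ∷ l) k) (λ n → inv (qint q n) * g n)
  represents-entry s t r l s≢0 eq rep = represents-congˡ
    (λ k → cong (sgn (suc k) * qtri (suc k) *_)
      (sym (tailSum-cum e₊ (s , t , r) l (λ k → calTerm-weight s t r k (eq k)) (suc k))))
    (represents-inv-qint (linked-cum₊ {leading ((s , t , r) ∷ l)}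
      (trans (cong (_* tailSum l 0) (weight-zero s t r s≢0)) (*-zeroˡ (tailSum l 0)))) rep)

  -- Each division by [n] calls for a factor [k] in the represented function; it is created as [k] ·
  -- 1/[k], and the 1/[k] becomes the weight of a new entry `(pos 1 , 0 , θ)`.
  represents-θs : ∀ {l g} → Represents (λ k → sgn k * qtri k * tailSum l k) g → ∀ m →
    Represents (λ k → sgn k * qtri k * tailSum (replicate m (pos 1 , 0 , θ) ++ l) k) (λ n → inv (qint q n ^ m) * g n)
  represents-θs {l} {g} rep zero = represents-congʳ (λ n → sym (*-identityˡ (g (suc n)))) rep
  represents-θs {l} {g} rep (suc m) = represents-congʳ
    (λ n → trans (sym (*-assoc (inv (qint q (suc n))) (inv (qint q (suc n) ^ m)) (g (suc n))))
                 (cong (_* g (suc n)) (sym (inv-* (qint q (suc n)) (qint q (suc n) ^ m)))))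
    (represents-entry (pos 1) 0 θ l′ refl (λ _ → refl)
      (represents-congˡ fold (represents-θs {l} {g} rep m)))
    where
    l′ = replicate m (pos 1 , 0 , θ) ++ l
    pad : ∀ u n i y → (n * i) * (u * y) ≡ n * (u * (1ℚ * (1ℚ * 1ℚ) * i * y))
    pad = solve-∀ ℚ-ring
    fold : ∀ k → sgn (suc k) * qtri (suc k) * tailSum l′ (suc k)
      ≡ qint q (suc k) * (sgn (suc k) * qtri (suc k) * leading ((pos 1 , 0 , θ) ∷ l′) (suc k))
    fold k = begin
      u * tailSum l′ (suc k)                        ≡⟨ sym (*-identityˡ (u * tailSum l′ (suc k))) ⟩
      1ℚ * (u * tailSum l′ (suc k))                 ≡⟨ cong (_* (u * tailSum l′ (suc k))) (sym (inv-inverseʳ (qint≢0 k))) ⟩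
      n * inv n * (u * tailSum l′ (suc k))
        ≡⟨ cong (λ y → n * inv y * (u * tailSum l′ (suc k))) (sym (*-identityʳ n)) ⟩
      n * inv (n ^ 1) * (u * tailSum l′ (suc k))    ≡⟨ pad u n (inv (n ^ 1)) (tailSum l′ (suc k)) ⟩
      n * (u * leading ((pos 1 , 0 , θ) ∷ l′) (suc k)) ∎
      where
      u = sgn (suc k) * qtri (suc k)
      n = qint q (suc k)

  represents-c : ∀ {f ss} m → Represents f (λ n → inv (qint q n ^ m) * star ss n) →
    Represents (λ k → weight₂ k * f k) (star (pos (2 ℕ.+ m) ∷ ss))
  represents-c {f} {ss} m rep = represents-congʳ
    (λ n → sumTo-cong (suc n) λ k _ → trans
      (swap (q ^ suc k) (inv (qint q (suc k) ^ 2)) (inv (qint q (suc k) ^ m)) (star ss (suc k)))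
      (cong (λ y → 1ℚ * q ^ suc k * y * star ss (suc k)) (sym (inv-^-+ (qint q (suc k)) 2 m))))
    (represents-weight₂ rep)
    where
    swap : ∀ x i j y → x * i * (j * y) ≡ 1ℚ * x * (i * j) * y
    swap = solve-∀ ℚ-ring

  -- Building whole blocks.

  record Leading (l : List Triple) : Set where
    field
      leading-zero : leading l 0 ≡ 0ℚ
      tailSum-leading : ∀ k → tailSum l k ≡ cum e₋ (leading l) k
  open Leading

  leading-₋1 : ∀ s t l {m} → ∣ s ∣ᴰ ≡ suc m → Leading ((s , t , int -[1+ 0 ]) ∷ l)
  leading-₋1 s t l s≢0 = record
    { leading-zero    = trans (cong (_* tailSum l 0) (weight-zero s t (int -[1+ 0 ]) s≢0)) (*-zeroˡ (tailSum l 0))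
    ; tailSum-leading = tailSum-cum e₋ (s , t , int -[1+ 0 ]) l (calTerm-weight-₋1 s t)
    }

  q^-+1 : ∀ m k → q ^ (m ℕ.* k) * q ^ k ≡ q ^ ((m ℕ.+ 1) ℕ.* k)
  q^-+1 m k = trans (sym (^-+ q (m ℕ.* k) k))
    (cong (q ^_) (trans (ℕₚ.+-comm (m ℕ.* k) k) (cong (ℕ._* k) (ℕₚ.+-comm 1 m))))

  -- Serves twice: the triple with value 2 is the head entry of case (B), and within a block it is
  -- the state just before the first division by [n].
  represents-twos-1 : ∀ {l ss} → Leading l → Represents (λ k → qtri k * qtri k * leading l k) (star ss) → ∀ m →
    Represents (λ k → weight (pos (2 ℕ.* m ℕ.+ 1) , m ℕ.+ 1 , int (+ 2)) k * tailSum l k)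
      (star (replicate m (pos 2) ++ pos 1 ∷ ss))
  represents-twos-1 {l} {ss} lead rep m = represents-congˡ (λ k → fold (suc k))
    (represents-twos {ss = pos 1 ∷ ss} (represents-1 {leading l} {ss} (leading-zero lead) rep) m)
    where
    swap : ∀ x y i j t u → x * i * (y * j * (t * t * u)) ≡ 1ℚ * (x * y * (t * t)) * (i * j) * u
    swap = solve-∀ ℚ-ring
    fold : ∀ k →
      q ^ (m ℕ.* k) * inv (qint q k ^ (2 ℕ.* m)) * (q ^ k * inv (qint q k ^ 1) * (qtri k * qtri k * cum e₋ (leading l) k))
      ≡ weight (pos (2 ℕ.* m ℕ.+ 1) , m ℕ.+ 1 , int (+ 2)) k * tailSum l k
    fold k = begin
      _ ≡⟨ swap (q ^ (m ℕ.* k)) (q ^ k) (inv (qint q k ^ (2 ℕ.* m))) (inv (qint q k ^ 1)) (qtri k) (cum e₋ (leading l) k) ⟩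
      1ℚ * (q ^ (m ℕ.* k) * q ^ k * (qtri k * qtri k)) * (inv (qint q k ^ (2 ℕ.* m)) * inv (qint q k ^ 1)) * cum e₋ (leading l) k
        ≡⟨ cong₂ (λ u v → 1ℚ * (u * (qtri k * qtri k)) * v * cum e₋ (leading l) k)
             (q^-+1 m k) (sym (inv-^-+ (qint q k) (2 ℕ.* m) 1)) ⟩
      1ℚ * (q ^ ((m ℕ.+ 1) ℕ.* k) * (qtri k * qtri k)) * inv (qint q k ^ (2 ℕ.* m ℕ.+ 1)) * cum e₋ (leading l) k
        ≡⟨ cong₂ _*_ (sym (weight-2 (pos (2 ℕ.* m ℕ.+ 1)) (m ℕ.+ 1) k)) (sym (tailSum-leading lead k)) ⟩
      _ ∎

  -- The first division by [n]. Of the two factors `qtri`, one goes into the prefactor and the other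
  -- stays as the value 1 of the entry; the sign in the prefactor is balanced by barring the entry,
  -- and the factor [k] taken out raises its exponent to 2m + 2.
  represents-edge-1 : ∀ {l ss} → Leading l → Represents (λ k → qtri k * qtri k * leading l k) (star ss) → ∀ m →
    Represents (λ k → sgn k * qtri k * tailSum (edge (int (+ 1)) m ∷ l) k)
      (λ n → inv (qint q n) * star (replicate m (pos 2) ++ pos 1 ∷ ss) n)
  represents-edge-1 {l} {ss} lead rep m =
    represents-entry (bar (2 ℕ.* m ℕ.+ 2)) (m ℕ.+ 1) (int (+ 1)) l (ℕₚ.+-suc (2 ℕ.* m) 1) (λ _ → refl)
      (represents-congˡ fold (represents-twos-1 lead rep m))
    where
    swap : ∀ s n x t i j u →
      (s * s) * (n * i) * (1ℚ * (x * (t * t)) * j * u) ≡ n * (s * t * (s * (x * t) * (i * j) * u))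
    swap = solve-∀ ℚ-ring
    fold : ∀ k → weight (pos (2 ℕ.* m ℕ.+ 1) , m ℕ.+ 1 , int (+ 2)) (suc k) * tailSum l (suc k)
      ≡ qint q (suc k) * (sgn (suc k) * qtri (suc k) * leading (edge (int (+ 1)) m ∷ l) (suc k))
    fold k′ = begin
      weight (pos (2 ℕ.* m ℕ.+ 1) , m ℕ.+ 1 , int (+ 2)) k * tailSum l k
        ≡⟨ cong (_* tailSum l k) (weight-2 (pos (2 ℕ.* m ℕ.+ 1)) (m ℕ.+ 1) k) ⟩
      y
        ≡⟨ sym (*-identityˡ y) ⟩
      1ℚ * 1ℚ * y
        ≡⟨ cong₂ (λ u v → u * v * y) (sym (sgn-square k)) (sym (inv-inverseʳ (qint≢0 k′))) ⟩
      sgn k * sgn k * (n * inv n) * y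
        ≡⟨ swap (sgn k) n x (qtri k) (inv n) (inv (n ^ (2 ℕ.* m ℕ.+ 1))) (tailSum l k) ⟩
      n * (sgn k * qtri k * (sgn k * (x * qtri k) * (inv n * inv (n ^ (2 ℕ.* m ℕ.+ 1))) * tailSum l k))
        ≡⟨ cong₂ (λ u v → n * (sgn k * qtri k * (u * (x * qtri k) * v * tailSum l k)))
             (sym (sgnPow-bar (2 ℕ.* m ℕ.+ 2) k))
             (trans (sym (inv-* n (n ^ (2 ℕ.* m ℕ.+ 1)))) (cong (λ i → inv (n ^ i)) (sym (ℕₚ.+-suc (2 ℕ.* m) 1)))) ⟩
      n * (sgn k * qtri k * (sgnPow (bar (2 ℕ.* m ℕ.+ 2)) k * (x * qtri k) * inv (n ^ (2 ℕ.* m ℕ.+ 2)) * tailSum l k))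
        ≡⟨ cong (λ u → n * (sgn k * qtri k * (u * tailSum l k))) (sym (weight-1 (bar (2 ℕ.* m ℕ.+ 2)) (m ℕ.+ 1) k)) ⟩
      n * (sgn k * qtri k * leading (edge (int (+ 1)) m ∷ l) k) ∎
      where
      k = suc k′
      n = qint q k
      x = q ^ ((m ℕ.+ 1) ℕ.* k)
      y = 1ℚ * (x * (qtri k * qtri k)) * inv (n ^ (2 ℕ.* m ℕ.+ 1)) * tailSum l k

  qtri-inv : ∀ s x i k → s * qtri k * x * i ≡ qtri k * qtri k * (s * (x * inv (qtri k)) * i)
  qtri-inv s x i k = trans (sym (*-identityˡ (s * qtri k * x * i)))
    (trans (cong (_* (s * qtri k * x * i)) (sym (inv-inverseʳ (q^≢0 (tri k)))))
           (swap s x i (qtri k) (inv (qtri k))))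
    where
    swap : ∀ s x i t j → t * j * (s * t * x * i) ≡ t * t * (s * (x * j) * i)
    swap = solve-∀ ℚ-ring

  -- Passing from the prefactor `sgn k * qtri k` to the boundary prefactor `qtri k * qtri k` leaves
  -- (-1)^k / `qtri k` behind, which makes the opening entry of a block barred with value -1.
  represents-edge-₋1 : ∀ {l g} m → Represents (λ k → weight₂ k * (sgn k * qtri k * tailSum l k)) (star g) →
    Represents (λ k → qtri k * qtri k * leading (edge (int -[1+ 0 ]) m ∷ l) k) (star (replicate m (pos 2) ++ g))
  represents-edge-₋1 {l} {g} m rep = represents-congˡ (λ k → fold (suc k)) (represents-twos {ss = g} rep m)
    where
    swap : ∀ x i y j s t u → x * i * (y * j * (s * t * u)) ≡ s * t * (x * y) * (i * j) * u
    swap = solve-∀ ℚ-ring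
    fold : ∀ k → q ^ (m ℕ.* k) * inv (qint q k ^ (2 ℕ.* m)) * (weight₂ k * (sgn k * qtri k * tailSum l k))
      ≡ qtri k * qtri k * leading (edge (int -[1+ 0 ]) m ∷ l) k
    fold k = begin
      q ^ (m ℕ.* k) * inv (n ^ (2 ℕ.* m)) * (weight₂ k * (sgn k * qtri k * tailSum l k))
        ≡⟨ swap (q ^ (m ℕ.* k)) (inv (n ^ (2 ℕ.* m))) (q ^ k) (inv (n ^ 2)) (sgn k) (qtri k) (tailSum l k) ⟩
      sgn k * qtri k * (q ^ (m ℕ.* k) * q ^ k) * (inv (n ^ (2 ℕ.* m)) * inv (n ^ 2)) * tailSum l k
        ≡⟨ cong₂ (λ u v → sgn k * qtri k * u * v * tailSum l k) (q^-+1 m k) (sym (inv-^-+ n (2 ℕ.* m) 2)) ⟩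
      sgn k * qtri k * x * i * tailSum l k
        ≡⟨ cong (λ s → s * qtri k * x * i * tailSum l k) (sym (sgnPow-bar (2 ℕ.* m ℕ.+ 2) k)) ⟩
      s * qtri k * x * i * tailSum l k
        ≡⟨ cong (_* tailSum l k) (qtri-inv s x i k) ⟩
      qtri k * qtri k * (s * (x * inv (qtri k)) * i) * tailSum l k
        ≡⟨ *-assoc (qtri k * qtri k) (s * (x * inv (qtri k)) * i) (tailSum l k) ⟩
      qtri k * qtri k * (s * (x * inv (qtri k)) * i * tailSum l k)
        ≡⟨ cong (λ u → qtri k * qtri k * (u * tailSum l k)) (sym (weight-₋1 (bar (2 ℕ.* m ℕ.+ 2)) (m ℕ.+ 1) k)) ⟩
      qtri k * qtri k * leading (edge (int -[1+ 0 ]) m ∷ l) k ∎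
      where
      n = qint q k
      x = q ^ ((m ℕ.+ 1) ℕ.* k)
      i = inv (n ^ (2 ℕ.* m ℕ.+ 2))
      s = sgnPow (bar (2 ℕ.* m ℕ.+ 2)) k

  -- The letter c = 3 + m accounts for m + 1 divisions by [n] followed by the factor `weight₂`: the
  -- first division yields the closing entry 1, the other m the `θ` entries, and `weight₂` together
  -- with the 2s in front yields the opening entry.
  represents-block : ∀ β → cOK β → ∀ {l ss} → Leading l →
    Represents (λ k → qtri k * qtri k * leading l k) (star ss) →
    Represents (λ k → qtri k * qtri k * leading (edge (int -[1+ 0 ]) (b β) ∷ innerEntries β l) k)
      (star (replicate (b β) (pos 2) ++ pos (c β) ∷ replicate (a β) (pos 2) ++ pos 1 ∷ ss))
  represents-block (blk b (suc (suc (suc m))) a) (s≤s (s≤s (s≤s _))) {l} {ss} lead rep =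
    represents-edge-₋1 {l = innerEntries (blk b (3 ℕ.+ m) a) l} {g = pos (3 ℕ.+ m) ∷ ss′} b
      (represents-c {ss = ss′} (suc m) (represents-congʳ powers
        (represents-θs {l = edge (int (+ 1)) a ∷ l} (represents-edge-1 {l} {ss} lead rep a) m)))
    where
    ss′ = replicate a (pos 2) ++ pos 1 ∷ ss
    swap : ∀ i j y → i * (j * y) ≡ j * i * y
    swap = solve-∀ ℚ-ring
    powers : ∀ n → inv (qint q (suc n) ^ m) * (inv (qint q (suc n)) * star ss′ (suc n))
      ≡ inv (qint q (suc n) ^ suc m) * star ss′ (suc n)
    powers n = trans (swap (inv (qint q (suc n) ^ m)) (inv (qint q (suc n))) (star ss′ (suc n)))
      (cong (_* star ss′ (suc n)) (sym (inv-* (qint q (suc n)) (qint q (suc n) ^ m))))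

  -- This is where the positivity of the last parameter enters: the final entry must have a positive
  -- power of [k] for its weight to vanish at 0.
  leading-tailEntries : ∀ βs {aL} → 1 ≤ aL → Leading (tailEntries βs aL)
  leading-tailEntries []       {suc m} _ = leading-₋1 (bar (2 ℕ.* suc m)) (suc m) [] refl
  leading-tailEntries (β ∷ βs) {aL}    _ = subst Leading (sym (tailEntries-∷ β βs aL))
    (leading-₋1 (bar (2 ℕ.* b β ℕ.+ 2)) (b β ℕ.+ 1) (innerEntries β (tailEntries βs aL)) (ℕₚ.+-suc (2 ℕ.* b β) 1))

  -- In the base case (-1)^k q^(k(k-1)/2) from `represents-one` is rewritten with the boundary
  -- prefactor; the leftover (-1)^k / `qtri k` is the final barred entry with value -1.
  represents-tailEntries : ∀ βs {aL} → 1 ≤ aL → All cOK βs →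
    Represents (λ k → qtri k * qtri k * leading (tailEntries βs aL) k) (star (sA βs aL))
  represents-tailEntries [] {aL} _ _ = subst
    (λ ss → Represents (λ k → qtri k * qtri k * leading (piFinal aL) k) (star ss)) (++-identityʳ (replicate aL (pos 2)))
    (represents-congˡ (λ k → fold (suc k)) (represents-twos {ss = []} represents-one aL))
    where
    swap : ∀ x i s t → x * i * (s * t) ≡ s * t * x * i
    swap = solve-∀ ℚ-ring
    fold : ∀ k → q ^ (aL ℕ.* k) * inv (qint q k ^ (2 ℕ.* aL)) * (sgn k * qtri k)
      ≡ qtri k * qtri k * leading (piFinal aL) k
    fold k = begin
      x * i * (sgn k * qtri k)
        ≡⟨ swap x i (sgn k) (qtri k) ⟩
      sgn k * qtri k * x * i
        ≡⟨ cong (λ s → s * qtri k * x * i) (sym (sgnPow-bar (2 ℕ.* aL) k)) ⟩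
      s * qtri k * x * i
        ≡⟨ qtri-inv s x i k ⟩
      qtri k * qtri k * (s * (x * inv (qtri k)) * i)
        ≡⟨ cong (qtri k * qtri k *_) (trans (sym (weight-₋1 (bar (2 ℕ.* aL)) aL k))
             (sym (*-identityʳ (weight (bar (2 ℕ.* aL) , aL , int -[1+ 0 ]) k)))) ⟩
      qtri k * qtri k * leading (piFinal aL) k ∎
      where
      x = q ^ (aL ℕ.* k)
      i = inv (qint q k ^ (2 ℕ.* aL))
      s = sgnPow (bar (2 ℕ.* aL)) k
  represents-tailEntries (β ∷ βs) {aL} 1≤aL (cβ ∷ cβs) =
    subst₂ (λ l ss → Represents (λ k → qtri k * qtri k * leading l k) (star ss))
      (sym (tailEntries-∷ β βs aL)) (sym (sA-∷ β βs aL))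
      (represents-block β cβ (leading-tailEntries βs 1≤aL) (represents-tailEntries βs 1≤aL cβs))

  -- The two cases of the theorem.

  -- The head's factor `1 + q^k` is the one built into `T`, so only its `weight` remains. The
  -- condition `Qf = slope` holds for the head values 1 and 2 of the two cases.
  sumMerges-T : ∀ s t r l → (∀ k → Qf r k ≡ slope r k) → Compatible r l →
    ∀ n → sumMerges q n ((s , t , r) ∷ l) ≡ T (leading ((s , t , r) ∷ l)) n
  sumMerges-T s t r l eq compat n = trans (sumMerges-∷ n (s , t , r) l) (sumTo-cong n λ k _ →
    cong (ratio q n (suc k) *_) (trans (mergedTerm-factor s t r l compat (suc k))
      (trans (cong (_* tailSum l (suc k)) (calTerm-weight s t r (suc k) (eq (suc k))))
             (*-assoc (1ℚ + q ^ suc k) (weight (s , t , r) (suc k)) (tailSum l (suc k))))))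

  -- In case (A) nothing precedes the first block, so its head absorbs the boundary prefactor; this
  -- turns the usual opening value -1 into the initial 1 of the third string.
  weight-flip : ∀ s t k → qtri k * qtri k * weight (s , t , int -[1+ 0 ]) k ≡ weight (s , t , int (+ 1)) k
  weight-flip s t k = begin
    qtri k * qtri k * weight (s , t , int -[1+ 0 ]) k
      ≡⟨ cong (qtri k * qtri k *_) (weight-₋1 s t k) ⟩
    qtri k * qtri k * (sgnPow s k * (x * inv (qtri k)) * i)
      ≡⟨ sym (qtri-inv (sgnPow s k) x i k) ⟩
    sgnPow s k * qtri k * x * i
      ≡⟨ swap (sgnPow s k) (qtri k) x i ⟩
    sgnPow s k * (x * qtri k) * i
      ≡⟨ sym (weight-1 s t k) ⟩
    weight (s , t , int (+ 1)) k ∎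
    where
    x = q ^ (t ℕ.* k)
    i = inv (qint q k ^ ∣ s ∣ᴰ)
    swap : ∀ s t x i → s * t * x * i ≡ s * (x * t) * i
    swap = solve-∀ ℚ-ring

  caseA : ∀ n {aL} → 1 ≤ aL → ∀ β βs → All cOK (β ∷ βs) →
    Hstar q (suc n) (sA (β ∷ βs) aL) ≡ - sumMerges q (suc n) (piA β βs aL)
  caseA n {aL} 1≤aL β βs ok = begin
    Hstar q (suc n) (sA (β ∷ βs) aL)
      ≡⟨ expansion (represents-tailEntries (β ∷ βs) 1≤aL ok) n ⟩
    - T (λ k → qtri k * qtri k * leading (tailEntries (β ∷ βs) aL) k) (suc n)
      ≡⟨ cong (λ l → - T (λ k → qtri k * qtri k * leading l k) (suc n)) (tailEntries-∷ β βs aL) ⟩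
    - T (λ k → qtri k * qtri k * leading (edge (int -[1+ 0 ]) (b β) ∷ inner) k) (suc n)
      ≡⟨ cong -_ (T-cong (λ k → flip (suc k)) (suc n)) ⟩
    - T (leading (edge (int (+ 1)) (b β) ∷ inner)) (suc n)
      ≡⟨ cong -_ (sym (sumMerges-T _ _ _ inner (λ _ → refl)
           (compatible-inner (int (+ 1)) β (tailEntries βs aL) (λ ()) (compatible-tail βs aL)) (suc n))) ⟩
    - sumMerges q (suc n) (edge (int (+ 1)) (b β) ∷ inner)
      ≡⟨ cong (λ l → - sumMerges q (suc n) l) (sym (piBlock-++ (int (+ 1)) β (tailEntries βs aL))) ⟩
    - sumMerges q (suc n) (piA β βs aL) ∎
    where
    inner = innerEntries β (tailEntries βs aL)
    flip : ∀ k → qtri k * qtri k * leading (edge (int -[1+ 0 ]) (b β) ∷ inner) k ≡ leading (edge (int (+ 1)) (b β) ∷ inner) k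
    flip k = trans (sym (*-assoc (qtri k * qtri k) (weight (edge (int -[1+ 0 ]) (b β)) k) (tailSum inner k)))
      (cong (_* tailSum inner k) (weight-flip (bar (2 ℕ.* b β ℕ.+ 2)) (b β ℕ.+ 1) k))

  caseB : ∀ n {aL} → 1 ≤ aL → ∀ a0 βs → All cOK βs →
    Hstar q (suc n) (sB a0 βs aL) ≡ - sumMerges q (suc n) (piB a0 βs aL)
  caseB n {aL} 1≤aL a0 βs ok = trans
    (expansion (represents-twos-1 {tailEntries βs aL} {sA βs aL} (leading-tailEntries βs 1≤aL) (represents-tailEntries βs 1≤aL ok) a0) n)
    (cong -_ (sym (sumMerges-T _ _ _ (tailEntries βs aL) (λ _ → refl) (compatible-tail βs aL (int (+ 2)) λ ()) (suc n))))

theorem6p7 : (q : ℚ) → 0ℚ < q → q < 1ℚ →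
    (n : ℕ) → 1 ≤ n → (aL : ℕ) → 1 ≤ aL →
    ((β₁ : Block) (βs : List Block) → All cOK (β₁ ∷ βs) →
    Hstar q n (sA (β₁ ∷ βs) aL) ≡ - sumMerges q n (piA β₁ βs aL))
    ×
    ((a0 : ℕ) (βs : List Block) → All cOK βs →
    Hstar q n (sB a0 βs aL) ≡ - sumMerges q n (piB a0 βs aL))
theorem6p7 q 0<q q<1 (suc n) _ aL 1≤aL = caseA n 1≤aL , caseB n 1≤aL
  where open Expansion q 0<q q<1
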